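{- Let $\varphi$ be a modal formula with $|\varphi|$ nodes, $d$ of which are modal (i.e. labelled $\Box$ or $\Diamond$). Evaluating $\varphi$ on one $n$-world model by the bitmask recurrence costs $O(|\varphi|+d\,n)$ word operations. Let $\mathfrak{F}$ be a set of $n$-world frames and let $k$ be the number of variables of $\varphi$. Deciding $\mathcal{F}\models\varphi$ for the frames $\mathcal{F}\in\mathfrak{F}$, by evaluating $\varphi$ under all valuations of its $k$ variables, costs $O\bigl(|\mathfrak{F}|\cdot 2^{kn}\cdot(|\varphi|+d\,n)\bigr)$ word operations in $O(|\mathfrak{F}|\,n)$ memory, and no (frame $\times$ valuation) truth tensor is stored.
   Context: Modal formulas over variables $p_0,p_1,\dots$ are generated by $\varphi ::= \top\mid\bot\mid p_i\mid\neg\varphi\mid\varphi\wedge\varphi\mid\varphi\vee\varphi\mid\varphi\rightarrow\varphi\mid\Box\varphi\mid\Diamond\varphi$; $|\varphi|$ is the node count. A frame is $\mathcal{F}=(W,R)$ with $W$ finite and $R\subseteq W^2$; a model adds a valuation $V$ assigning to each variable a subset of $W$. $\mathcal{F}\models\varphi$ means $\varphi$ is true (in the standard Kripke semantics) at every world under every valuation. Bitmask recurrence on $W=\{0,\dots,n-1\}$: a subset $S$ is encoded as one integer (one machine word) $\widehat S=\sum_{w\in S}2^w$; $\mathit{full}=2^n-1$; $\&,|,\sim$ are bitwise AND, OR, NOT; $\overline{x}=\mathit{full}\mathbin{\&}(\sim x)$; a frame is the array of $n$ successor masks $\mathrm{succ}[w]=\widehat{\{v:R(w,v)\}}$; a valuation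 is one mask $\widehat{V(p_i)}$ per variable. The integer $m(\varphi)$ is computed by $m(\top)=\mathit{full}$, $m(\bot)=0$, $m(p_i)=\widehat{V(p_i)}$, $m(\neg\varphi)=\overline{m(\varphi)}$, $m(\varphi\wedge\psi)=m(\varphi)\mathbin{\&}m(\psi)$, $m(\varphi\vee\psi)=m(\varphi)\mathbin{|}m(\psi)$, $m(\varphi\rightarrow\psi)=\overline{m(\varphi)}\mathbin{|}m(\psi)$; for each $w<n$ in a loop, bit $w$ of $m(\Box\varphi)$ is $1$ iff $\mathrm{succ}[w]\mathbin{\&}\overline{m(\varphi)}=0$, and bit $w$ of $m(\Diamond\varphi)$ is $1$ iff $\mathrm{succ}[w]\mathbin{\&}m(\varphi)\neq0$. A frame validates $\varphi$ iff $m(\varphi)=\mathit{full}$ under every valuation. Bitwise operations on and comparisons of masks are single word operations. Valuations are enumerated by index rather than stored. The truth tensor referred to is the array of truth values indexed by frame and valuation. -}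

module Defs where

open import Data.Bool.Base using (Bool; if_then_else_)
import Data.Empty as Empty
open import Data.Fin.Base using (Fin; toℕ)
open import Data.Fin.Subset using (Subset; _∈_; _∩_; _∪_; ∁)
open import Data.List.Base as List using (List; []; _∷_; [_]; _++_; length)
open import Data.Nat.Base using (ℕ; zero; suc; _+_; _*_; _∸_; _^_; _<_)
open import Data.Nat.DivMod using (_/_; _%_)
open import Data.Nat.ListAction using (sum)
import Data.Nat.Properties as ℕ
open import Data.Product.Base using (_×_; _,_; Σ-syntax; ∃-syntax)
open import Data.Product.Properties using (≡-dec)
open import Data.Sum.Base using (_⊎_)
import Data.Unit.Base as Unit
open import Data.Vec.Base as Vec using (Vec; lookup; tabulate)
open import Relation.Binary.Definitions using (DecidableEquality)
open import Relation.Binary.PropositionalEquality using (_≡_; refl; cong; sym; trans)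
open import Relation.Nullary.Decidable using (Dec; does; ¬?; map′)

------------------------------------------------------------------------
-- Modal formulas and Kripke semantics

infix  9 ¬_ □_ ◇_
infixr 7 _∧_
infixr 6 _∨_
infixr 5 _⇒_

data Formula : Set where
  ⊤ ⊥         : Formula
  var         : ℕ → Formula
  ¬_ □_ ◇_    : Formula → Formula
  _∧_ _∨_ _⇒_ : Formula → Formula → Formula

size : Formula → ℕ
size ⊤       = 1
size ⊥       = 1
size (var i) = 1
size (¬ φ)   = suc (size φ)
size (□ φ)   = suc (size φ)
size (◇ φ)   = suc (size φ)
size (φ ∧ ψ) = suc (size φ + size ψ)
size (φ ∨ ψ) = suc (size φ + size ψ)
size (φ ⇒ ψ) = suc (size φ + size ψ)

modalNodes : Formula → ℕ
modalNodes ⊤       = 0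
modalNodes ⊥       = 0
modalNodes (var i) = 0
modalNodes (¬ φ)   = modalNodes φ
modalNodes (□ φ)   = suc (modalNodes φ)
modalNodes (◇ φ)   = suc (modalNodes φ)
modalNodes (φ ∧ ψ) = modalNodes φ + modalNodes ψ
modalNodes (φ ∨ ψ) = modalNodes φ + modalNodes ψ
modalNodes (φ ⇒ ψ) = modalNodes φ + modalNodes ψ

occurrences : Formula → List ℕ
occurrences ⊤       = []
occurrences ⊥       = []
occurrences (var i) = [ i ]
occurrences (¬ φ)   = occurrences φ
occurrences (□ φ)   = occurrences φ
occurrences (◇ φ)   = occurrences φ
occurrences (φ ∧ ψ) = occurrences φ ++ occurrences ψ
occurrences (φ ∨ ψ) = occurrences φ ++ occurrences ψ
occurrences (φ ⇒ ψ) = occurrences φ ++ occurrences ψ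

vars : Formula → List ℕ
vars φ = List.deduplicate ℕ._≟_ (occurrences φ)

numVars : Formula → ℕ
numVars φ = length (vars φ)

-- The worlds are the elements of Fin n, and R(w,v) is v ∈ lookup F w.
Frame : ℕ → Set
Frame n = Vec (Subset n) n

Valuation : ℕ → Set
Valuation n = ℕ → Subset n

infix 4 _,_,_⊩_ _⊨_

_,_,_⊩_ : ∀ {n} → Frame n → Valuation n → Fin n → Formula → Set
F , V , w ⊩ ⊤       = Unit.⊤
F , V , w ⊩ ⊥       = Empty.⊥
F , V , w ⊩ var i   = w ∈ V i
F , V , w ⊩ (¬ φ)   = F , V , w ⊩ φ → Empty.⊥
F , V , w ⊩ (φ ∧ ψ) = (F , V , w ⊩ φ) × (F , V , w ⊩ ψ)
F , V , w ⊩ (φ ∨ ψ) = (F , V , w ⊩ φ) ⊎ (F , V , w ⊩ ψ)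
F , V , w ⊩ (φ ⇒ ψ) = F , V , w ⊩ φ → F , V , w ⊩ ψ
F , V , w ⊩ (□ φ)   = ∀ v → v ∈ lookup F w → F , V , v ⊩ φ
F , V , w ⊩ (◇ φ)   = ∃[ v ] v ∈ lookup F w × (F , V , v ⊩ φ)

_⊨_ : ∀ {n} → Frame n → Formula → Set
F ⊨ φ = ∀ V w → F , V , w ⊩ φ

------------------------------------------------------------------------
-- Masks

encode : ∀ {n} → Subset n → ℕ
encode S = sum (List.tabulate λ w → if lookup S w then 2 ^ toℕ w else 0)

fullMask : ℕ → ℕ
fullMask n = 2 ^ n ∸ 1

bit : ℕ → ℕ → Bool
bit x zero    = does (x % 2 ℕ.≟ 1)
bit x (suc i) = bit (x / 2) i

-- The operations of a machine whose words have b bits.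
module Word (b : ℕ) where

  bits : ℕ → Subset b
  bits x = tabulate λ i → bit x (toℕ i)

  infixr 7 _&_
  infixr 6 _∣_
  infix  8 ~_ 1<<_

  _&_ _∣_ : ℕ → ℕ → ℕ
  x & y = encode (bits x ∩ bits y)
  x ∣ y = encode (bits x ∪ bits y)

  ~_ 1<<_ : ℕ → ℕ
  ~ x    = encode (∁ (bits x))
  1<< w  = _%_ (2 ^ w) (2 ^ b) {{ℕ.m^n≢0 2 b}}

-- The value m(φ), on words of b bits.
module Recurrence (b : ℕ) {n : ℕ} (F : Frame n) (V : Valuation n) where
  open Word b

  infix 8 _ᶜ

  _ᶜ : ℕ → ℕ
  x ᶜ = fullMask n & ~ x

  succMask : Fin n → ℕ
  succMask w = encode (lookup F w)

  m : Formula → ℕ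
  m ⊤       = fullMask n
  m ⊥       = 0
  m (var i) = encode (V i)
  m (¬ φ)   = m φ ᶜ
  m (φ ∧ ψ) = m φ & m ψ
  m (φ ∨ ψ) = m φ ∣ m ψ
  m (φ ⇒ ψ) = m φ ᶜ ∣ m ψ
  m (□ φ)   = encode (tabulate λ w → does (succMask w & m φ ᶜ ℕ.≟ 0))
  m (◇ φ)   = encode (tabulate λ w → does (¬? (succMask w & m φ ℕ.≟ 0)))

------------------------------------------------------------------------
-- A word machine

-- Each cell holds one word (or one loop index).
data Cell : Set where
  numFrames numWorlds full : Cell          -- parameters |𝔉|, n and 2ⁿ ∸ 1
  frame world              : Cell          -- current indices
  succ                     : ℕ → ℕ → Cell  -- succ f w: successor mask of w in frame f
  val                      : ℕ → Cell      -- val i: mask of variable i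
  tmp                      : ℕ → Cell
  ans                      : ℕ → Cell      -- ans f: verdict on frame f

private
  code : Cell → ℕ × ℕ × ℕ
  code numFrames  = 0 , 0 , 0
  code numWorlds  = 1 , 0 , 0
  code full       = 2 , 0 , 0
  code frame      = 3 , 0 , 0
  code world      = 4 , 0 , 0
  code (succ f w) = 5 , f , w
  code (val i)    = 6 , i , 0
  code (tmp j)    = 7 , j , 0
  code (ans f)    = 8 , f , 0

  decode : ℕ × ℕ × ℕ → Cell
  decode (0 , _ , _) = numFrames
  decode (1 , _ , _) = numWorlds
  decode (2 , _ , _) = full
  decode (3 , _ , _) = frame
  decode (4 , _ , _) = world
  decode (5 , f , w) = succ f w
  decode (6 , i , _) = val i
  decode (7 , j , _) = tmp j
  decode (_ , f , _) = ans f

  decode-code : ∀ c → decode (code c) ≡ c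
  decode-code numFrames  = refl
  decode-code numWorlds  = refl
  decode-code full       = refl
  decode-code frame      = refl
  decode-code world      = refl
  decode-code (succ f w) = refl
  decode-code (val i)    = refl
  decode-code (tmp j)    = refl
  decode-code (ans f)    = refl

infix 4 _≟_

_≟_ : DecidableEquality Cell
c ≟ c′ = map′
  (λ eq → trans (sym (decode-code c)) (trans (cong decode eq) (decode-code c′)))
  (cong code)
  (≡-dec ℕ._≟_ (≡-dec ℕ._≟_ ℕ._≟_) (code c) (code c′))

Memory : Set
Memory = Cell → ℕ

_[_≔_] : Memory → Cell → ℕ → Memory
(σ [ c ≔ x ]) c′ = if does (c′ ≟ c) then x else σ c′

-- succ[·] is the successor mask of the current world in the current frame, and
-- ans[·] the verdict on the current frame.
data Ref : Set where
  at          : Cell → Ref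
  succ[·]     : Ref
  ans[·]      : Ref

data Operand : Set where
  ref : Ref → Operand
  lit : ℕ → Operand

data Expr : Set where
  get shiftOne not : Operand → Expr
  _and_ _or_       : Operand → Operand → Expr

infixr 4 _⨾_
infix  5 _:=_ for_below_repeat_ for_upto_repeat_ test_==_then_else_

data Program : Set where
  skip             : Program
  _⨾_              : Program → Program → Program
  _:=_             : Ref → Expr → Program
  test_==_then_else_ : Operand → Operand → Program → Program → Program
  for_below_repeat_   : Cell → Cell → Program → Program  -- counter runs over 0, …, bound − 1
  for_upto_repeat_    : Cell → Cell → Program → Program  -- counter runs over 0, …, bound

-- The final memory, the number of word operations, and all cells read and written.
record Outcome : Set where
  constructor outcome
  field
    memory : Memory
    ops    : ℕ
    reads  : List Cell
    writes : List Cell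
open Outcome public

infixl 1 _>>=_

_>>=_ : Outcome → (Memory → Outcome) → Outcome
o >>= k = outcome (memory o′) (ops o + ops o′) (reads o ++ reads o′) (writes o ++ writes o′)
  where o′ = k (memory o)

iterate : (Memory → Outcome) → Cell → ℕ → ℕ → Memory → Outcome
iterate body c i zero    σ = outcome σ 0 [] []
iterate body c i (suc k) σ =
  outcome (σ [ c ≔ i ]) 1 [ c ] [ c ] >>= body >>= iterate body c (suc i) k

module Machine (b : ℕ) where
  open Word b

  address : Memory → Ref → Cell
  address σ (at c)  = c
  address σ succ[·] = succ (σ frame) (σ world)
  address σ ans[·]  = ans (σ frame)

  addressing : Ref → List Cell
  addressing (at c)  = []
  addressing succ[·] = frame ∷ world ∷ []
  addressing ans[·]  = frame ∷ []

  value : Memory → Operand → ℕ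
  value σ (ref r) = σ (address σ r)
  value σ (lit x) = x

  operandReads : Memory → Operand → List Cell
  operandReads σ (ref r) = address σ r ∷ addressing r
  operandReads σ (lit x) = []

  eval : Memory → Expr → ℕ
  eval σ (get o)      = value σ o
  eval σ (shiftOne o) = 1<< value σ o
  eval σ (not o)      = ~ value σ o
  eval σ (o and o′)   = value σ o & value σ o′
  eval σ (o or o′)    = value σ o ∣ value σ o′

  exprReads : Memory → Expr → List Cell
  exprReads σ (get o)      = operandReads σ o
  exprReads σ (shiftOne o) = operandReads σ o
  exprReads σ (not o)      = operandReads σ o
  exprReads σ (o and o′)   = operandReads σ o ++ operandReads σ o′
  exprReads σ (o or o′)    = operandReads σ o ++ operandReads σ o′

  -- One operation is charged per assignment, per comparison, and per loop iteration
  -- (advancing the counter and testing it against the bound).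
  run : Program → Memory → Outcome
  run skip σ = outcome σ 0 [] []
  run (p ⨾ q) σ = run p σ >>= run q
  run (r := e) σ =
    outcome (σ [ address σ r ≔ eval σ e ]) 1 (addressing r ++ exprReads σ e) [ address σ r ]
  run (test o == o′ then p else q) σ =
    outcome σ 1 (operandReads σ o ++ operandReads σ o′) [] >>=
    (if does (value σ o ℕ.≟ value σ o′) then run p else run q)
  run (for c below d repeat p) σ =
    outcome σ 0 [ d ] [] >>= iterate (run p) c 0 (σ d)
  run (for c upto d repeat p) σ =
    outcome σ 0 [ d ] [] >>= iterate (run p) c 0 (suc (σ d))

------------------------------------------------------------------------
-- The evaluation and decision programs

↑ : Cell → Operand
↑ c = ref (at c)

complement : ℕ → ℕ → Program
complement j i =
  at (tmp j) := not (↑ (tmp i)) ⨾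
  at (tmp j) := ↑ full and ↑ (tmp j)

setCurrentBit : ℕ → Program
setCurrentBit j =
  at (tmp (2 + j)) := shiftOne (↑ world) ⨾
  at (tmp j) := ↑ (tmp j) or ↑ (tmp (2 + j))

-- Leaves m(φ) in tmp j, without disturbing tmp i for i < j.
evaluateAt : ℕ → Formula → Program
evaluateAt j ⊤       = at (tmp j) := get (↑ full)
evaluateAt j ⊥       = at (tmp j) := get (lit 0)
evaluateAt j (var i) = at (tmp j) := get (↑ (val i))
evaluateAt j (¬ φ)   = evaluateAt j φ ⨾ complement j j
evaluateAt j (φ ∧ ψ) =
  evaluateAt j φ ⨾ evaluateAt (suc j) ψ ⨾
  at (tmp j) := ↑ (tmp j) and ↑ (tmp (suc j))
evaluateAt j (φ ∨ ψ) =
  evaluateAt j φ ⨾ evaluateAt (suc j) ψ ⨾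
  at (tmp j) := ↑ (tmp j) or ↑ (tmp (suc j))
evaluateAt j (φ ⇒ ψ) =
  evaluateAt j φ ⨾ complement j j ⨾ evaluateAt (suc j) ψ ⨾
  at (tmp j) := ↑ (tmp j) or ↑ (tmp (suc j))
evaluateAt j (□ φ)   =
  evaluateAt j φ ⨾
  complement (suc j) j ⨾
  at (tmp j) := get (lit 0) ⨾
  for world below numWorlds repeat (
    at (tmp (2 + j)) := ref succ[·] and ↑ (tmp (suc j)) ⨾
    test ↑ (tmp (2 + j)) == lit 0 then setCurrentBit j else skip)
evaluateAt j (◇ φ)   =
  evaluateAt j φ ⨾
  at (tmp (suc j)) := get (↑ (tmp j)) ⨾
  at (tmp j) := get (lit 0) ⨾
  for world below numWorlds repeat (
    at (tmp (2 + j)) := ref succ[·] and ↑ (tmp (suc j)) ⨾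
    test ↑ (tmp (2 + j)) == lit 0 then skip else setCurrentBit j)

evaluate : Formula → Program
evaluate = evaluateAt 0

-- The nested counters are the base-2ⁿ digits of the index of a valuation of is.
forValuations : List ℕ → Program → Program
forValuations []       p = p
forValuations (i ∷ is) p = for val i upto full repeat forValuations is p

decide : Formula → Program
decide φ =
  for frame below numFrames repeat (
    ans[·] := get (lit 1) ⨾
    forValuations (vars φ) (
      evaluate φ ⨾
      test ↑ (tmp 0) == ↑ full then skip else (ans[·] := get (lit 0))))

------------------------------------------------------------------------
-- Inputs and memory use

record HoldsModel {n} (σ : Memory) (F : Frame n) (V : Valuation n) : Set where
  field
    worlds : σ numWorlds ≡ n
    ones   : σ full ≡ fullMask n
    masks  : ∀ w → σ (succ (σ frame) (toℕ w)) ≡ encode (lookup F w)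
    values : ∀ i → σ (val i) ≡ encode (V i)

record HoldsFrames {n N} (σ : Memory) (𝔉 : Vec (Frame n) N) : Set where
  field
    frames : σ numFrames ≡ N
    worlds : σ numWorlds ≡ n
    ones   : σ full ≡ fullMask n
    masks  : ∀ f w → σ (succ (toℕ f) (toℕ w)) ≡ encode (lookup (lookup 𝔉 f) w)

inputCells : ℕ → ℕ → List Cell
inputCells N n =
  numFrames ∷ numWorlds ∷ full ∷ List.cartesianProductWith succ (List.upTo N) (List.upTo n)

-- The number of distinct cells holding the input or used during the run.
cellsUsed : (N n : ℕ) → Outcome → ℕ
cellsUsed N n o = length (List.deduplicate _≟_ (inputCells N n ++ reads o ++ writes o))

Verdict : ∀ {n} → Frame n → Formula → ℕ → Set
Verdict F φ x = Σ[ d ∈ Dec (F ⊨ φ) ] x ≡ (if does d then 1 else 0)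

IsAnswerOf : ℕ → Cell → Set
IsAnswerOf N c = ∃[ f ] f < N × c ≡ ans f

{-# OPTIONS --safe #-}
module Submission where

-- Subsets and their masks are identified bitwise, so that m φ encodes the truth set of φ, and
-- m φ is the full mask exactly when φ holds at every world. The programs are analysed by one
-- triple that records the postcondition, the time, the cells read and the cells written together;
-- everything not written is known to be unchanged, which lets nested evaluations and loops
-- be composed. The loop nest over the variables is an induction in which the verdict of a frame is,
-- at each level, the conjunction of its previous value with the truth of φ under all valuations
-- that differ from the current one only in the variables of the inner loops.

open import Defs
open import Data.Bool.Base as Bool using (Bool; true; false; if_then_else_)
import Data.Bool.Properties as Bool
open import Data.Fin.Base as Fin using (Fin; zero; suc; toℕ)
import Data.Fin.Properties as Fin
open import Data.Fin.Subset as Subset using (Subset; _∩_; _∪_; ∁; ⁅_⁆)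
import Data.Fin.Subset.Properties as Subset
open import Data.List.Base as List using (List; []; _∷_; _++_; length)
open import Data.List.Membership.Propositional using (_∈_; _∉_)
open import Data.List.Membership.Propositional.Properties
open import Data.List.Relation.Binary.Subset.Propositional using (_⊆_)
import Data.List.Properties as List
open import Data.List.Relation.Unary.All as All using (All; []; _∷_)
import Data.List.Relation.Unary.All.Properties as All
open import Data.List.Relation.Unary.Any using (here; there)
open import Data.List.Relation.Unary.AllPairs using ([]; _∷_)
import Data.List.Relation.Unary.Unique.Propositional as List using (Unique)
import Data.List.Relation.Unary.Unique.DecPropositional.Properties as List
open import Data.Nat.Base
  using (ℕ; zero; suc; _+_; _*_; _∸_; _^_; _≤_; _<_; z≤n; s≤s; s≤s⁻¹; NonZero)
open import Data.Nat.DivMod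
open import Data.Nat.Divisibility using (n∣m*n)
open import Data.Nat.ListAction using (sum)
import Data.Nat.Properties as ℕ
open import Data.Nat.Tactic.RingSolver using (solve-∀)
open import Data.Product.Base using (_×_; _,_; proj₁; ∃-syntax; Σ-syntax)
open import Data.Sum.Base using (_⊎_; inj₁; inj₂)
import Data.Unit.Base as Unit
open import Data.Vec.Base as Vec using (Vec; []; _∷_; lookup; tabulate)
import Data.Vec.Properties as Vec
open import Data.Vec.Relation.Unary.Unique.Propositional using (Unique)
open import Function.Base using (_∘_; id; const)
open import Function.Bundles using (_⇔_; mk⇔; module Equivalence)
open import Function.Construct.Composition using (_⇔-∘_)
open import Function.Related.TypeIsomorphisms using (¬-cong-⇔)
open import Relation.Binary.PropositionalEquality
import Relation.Nullary as Nullary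
open import Relation.Nullary.Decidable as Dec
  using (Dec; yes; no; does; ¬?; _×-dec_; _⊎-dec_; _→-dec_; does-⇔)
open import Relation.Nullary.Negation using (contradiction)

-- Masks and truth sets

-- The semantics lives on `n` worlds and the machine on words of `b` bits with `n ≤ b`. The two meet
-- in the numbers `encode S`, which do not change when a vector is padded with `false`. Valuations
-- are functions on all variables, while a run fixes only those of `φ`. Assertions about the loop
-- nest therefore speak of all valuations that agree with a given one on the variables already set,
-- so that no equality of functions has to be proved. Reads and writes are bounded by predicates,
-- since the recorded lists are exponentially long and full of repetitions; the memory bound then
-- only compares a repetition-free list with a list containing its elements. The constant 5 comes
-- from the modal loops, which cost at most five operations per world; the work outside these loops
-- is at most three operations per node. In the decision, a loop over a variable adds one operation
-- per iteration, charged to the innermost runs. With `k ≤ |φ|`, two operations for each check and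
-- two for each frame, this gives 10.

digit : Bool → ℕ
digit p = if p then 1 else 0

sum-tabulate-* : ∀ {n} (f : Fin n → ℕ) k →
  sum (List.tabulate λ i → f i * k) ≡ sum (List.tabulate f) * k
sum-tabulate-* {zero}  f k = refl
sum-tabulate-* {suc n} f k =
  trans (cong (f zero * k +_) (sum-tabulate-* (f ∘ suc) k))
        (sym (ℕ.*-distribʳ-+ k (f zero) (sum (List.tabulate (f ∘ suc)))))

-- Horner's scheme: the head is the parity and the tail the half, which is how `bit` takes a number
-- apart.
encode-∷ : ∀ {n} p (S : Subset n) → encode (p ∷ S) ≡ digit p + encode S * 2
encode-∷ p S = cong (digit p +_) (trans
  (cong sum (List.tabulate-cong λ i → double (lookup S i) (toℕ i)))
  (sum-tabulate-* (λ i → if lookup S i then 2 ^ toℕ i else 0) 2))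
  where
  double : ∀ p i → (if p then 2 ^ suc i else 0) ≡ (if p then 2 ^ i else 0) * 2
  double true  i = ℕ.*-comm 2 (2 ^ i)
  double false i = refl

bit-zero : ∀ p y → bit (digit p + y * 2) 0 ≡ p
bit-zero true  y = cong (λ x → does (x ℕ.≟ 1)) ([m+kn]%n≡m%n 1 y 2)
bit-zero false y = cong (λ x → does (x ℕ.≟ 1)) (m*n%n≡0 y 2)

digit-half : ∀ p y → (digit p + y * 2) / 2 ≡ y
digit-half p y = trans (+-distrib-/-∣ʳ (digit p) (n∣m*n y)) (cong₂ _+_ (small p) (m*n/n≡m y 2))
  where
  small : ∀ p → digit p / 2 ≡ 0
  small true  = refl
  small false = refl

-- Total lookup, false outside the range: masks of different lengths become comparable.
infix 9 _‼_

_‼_ : ∀ {n} → Subset n → ℕ → Bool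
[]      ‼ i     = false
(p ∷ S) ‼ zero  = p
(p ∷ S) ‼ suc i = S ‼ i

bit-encode : ∀ {n} (S : Subset n) i → bit (encode S) i ≡ S ‼ i
bit-encode []      zero    = refl
bit-encode []      (suc i) = bit-encode [] i
bit-encode (p ∷ S) zero    = trans (cong (λ x → bit x 0) (encode-∷ p S)) (bit-zero p (encode S))
bit-encode (p ∷ S) (suc i) = trans
  (cong (λ x → bit (x / 2) i) (encode-∷ p S))
  (trans (cong (λ x → bit x i) (digit-half p (encode S))) (bit-encode S i))

‼-lookup : ∀ {n} (S : Subset n) w → S ‼ toℕ w ≡ lookup S w
‼-lookup (p ∷ S) zero    = refl
‼-lookup (p ∷ S) (suc w) = ‼-lookup S w

‼-≥ : ∀ {n} (S : Subset n) {i} → n ≤ i → S ‼ i ≡ false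
‼-≥ []      _         = refl
‼-≥ (p ∷ S) (s≤s n≤i) = ‼-≥ S n≤i

‼-∩ : ∀ {n} (S T : Subset n) i → (S ∩ T) ‼ i ≡ S ‼ i Bool.∧ T ‼ i
‼-∩ []      []      i       = refl
‼-∩ (p ∷ S) (q ∷ T) zero    = refl
‼-∩ (p ∷ S) (q ∷ T) (suc i) = ‼-∩ S T i

‼-∪ : ∀ {n} (S T : Subset n) i → (S ∪ T) ‼ i ≡ S ‼ i Bool.∨ T ‼ i
‼-∪ []      []      i       = refl
‼-∪ (p ∷ S) (q ∷ T) zero    = refl
‼-∪ (p ∷ S) (q ∷ T) (suc i) = ‼-∪ S T i

‼-∁ : ∀ {n} (S : Subset n) {i} → i < n → ∁ S ‼ i ≡ Bool.not (S ‼ i)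
‼-∁ (p ∷ S) {zero}  _         = refl
‼-∁ (p ∷ S) {suc i} (s≤s i<n) = ‼-∁ S i<n

‼-⊤ : ∀ {n i} → i < n → Subset.⊤ {n} ‼ i ≡ true
‼-⊤ {suc n} {zero}  _         = refl
‼-⊤ {suc n} {suc i} (s≤s i<n) = ‼-⊤ i<n

encode-⊥ : ∀ n → encode (Subset.⊥ {n}) ≡ 0
encode-⊥ zero    = refl
encode-⊥ (suc n) = trans (encode-∷ false (Subset.⊥ {n})) (cong (_* 2) (encode-⊥ n))

-- The lengths may differ because a missing position counts as `false` and contributes 0 to the sum.
-- This equates results on `b`-bit vectors with subsets of the `n` worlds.
encode-cong : ∀ {m n} (S : Subset m) (T : Subset n) → (∀ i → S ‼ i ≡ T ‼ i) → encode S ≡ encode T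
encode-cong {n = n} [] T S≗T = sym (trans (cong encode (empty T (sym ∘ S≗T))) (encode-⊥ n))
  where
  empty : ∀ {n} (T : Subset n) → (∀ i → T ‼ i ≡ false) → T ≡ Subset.⊥
  empty []      _ = refl
  empty (p ∷ T) h = cong₂ _∷_ (h 0) (empty T (h ∘ suc))
encode-cong S@(_ ∷ _) [] S≗T = sym (encode-cong [] S (sym ∘ S≗T))
encode-cong (p ∷ S) (q ∷ T) S≗T = begin
  encode (p ∷ S)          ≡⟨ encode-∷ p S ⟩
  digit p + encode S * 2  ≡⟨ cong₂ (λ p x → digit p + x * 2) (S≗T 0) (encode-cong S T (S≗T ∘ suc)) ⟩
  digit q + encode T * 2  ≡⟨ encode-∷ q T ⟨
  encode (q ∷ T)          ∎
  where open ≡-Reasoning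

encode-injective : ∀ {n} {S T : Subset n} → encode S ≡ encode T → S ≡ T
encode-injective {S = S} {T} eq = trans (sym (Vec.tabulate∘lookup S))
  (trans (Vec.tabulate-cong same) (Vec.tabulate∘lookup T))
  where
  open ≡-Reasoning
  same : ∀ w → lookup S w ≡ lookup T w
  same w = begin
    lookup S w              ≡⟨ ‼-lookup S w ⟨
    S ‼ toℕ w               ≡⟨ bit-encode S (toℕ w) ⟨
    bit (encode S) (toℕ w)  ≡⟨ cong (λ x → bit x (toℕ w)) eq ⟩
    bit (encode T) (toℕ w)  ≡⟨ bit-encode T (toℕ w) ⟩
    T ‼ toℕ w               ≡⟨ ‼-lookup T w ⟩
    lookup T w              ∎

encode-⊤ : ∀ n → suc (encode (Subset.⊤ {n})) ≡ 2 ^ n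
encode-⊤ zero    = refl
encode-⊤ (suc n) = trans (cong suc (encode-∷ true (Subset.⊤ {n})))
  (trans (cong (_* 2) (encode-⊤ n)) (ℕ.*-comm (2 ^ n) 2))

fullMask-⊤ : ∀ n → fullMask n ≡ encode (Subset.⊤ {n})
fullMask-⊤ n = cong (_∸ 1) (sym (encode-⊤ n))

suc-fullMask : ∀ n → suc (fullMask n) ≡ 2 ^ n
suc-fullMask n = trans (cong suc (fullMask-⊤ n)) (encode-⊤ n)

encode-⁅⁆ : ∀ {n} (w : Fin n) → encode ⁅ w ⁆ ≡ 2 ^ toℕ w
encode-⁅⁆ {suc n} zero    = trans (encode-∷ true (Subset.⊥ {n})) (cong (λ x → 1 + x * 2) (encode-⊥ n))
encode-⁅⁆ {suc n} (suc w) = trans (encode-∷ false ⁅ w ⁆)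
  (trans (cong (_* 2) (encode-⁅⁆ w)) (ℕ.*-comm (2 ^ toℕ w) 2))

encode-< : ∀ {n} (S : Subset n) → encode S < 2 ^ n
encode-< []          = s≤s z≤n
encode-< {suc n} (p ∷ S) = begin-strict
  encode (p ∷ S)          ≡⟨ encode-∷ p S ⟩
  digit p + encode S * 2  <⟨ ℕ.+-monoˡ-< (encode S * 2) (digit-< p) ⟩
  suc (encode S) * 2      ≤⟨ ℕ.*-monoˡ-≤ 2 (encode-< S) ⟩
  2 ^ n * 2               ≡⟨ ℕ.*-comm (2 ^ n) 2 ⟩
  2 ^ suc n               ∎
  where
  open ℕ.≤-Reasoning
  digit-< : ∀ p → digit p < 2
  digit-< true  = s≤s (s≤s z≤n)
  digit-< false = s≤s z≤n

-- Lets every value of a loop counter below `2 ^ n` be read as a value of a variable.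
encode-bits : ∀ n {x} → x < 2 ^ n → encode (Word.bits n x) ≡ x
encode-bits zero    {zero} _ = refl
encode-bits zero    {suc x} (s≤s ())
encode-bits (suc n) {x} x<2ⁿ = begin
  encode (Word.bits (suc n) x)                        ≡⟨ encode-∷ (bit x 0) (Word.bits n (x / 2)) ⟩
  digit (bit x 0) + encode (Word.bits n (x / 2)) * 2  ≡⟨ cong₂ _+_ (parity (m%n<n x 2))
                                                          (cong (_* 2) (encode-bits n x/2<2ⁿ)) ⟩
  x % 2 + x / 2 * 2                                   ≡⟨ m≡m%n+[m/n]*n x 2 ⟨
  x                                                   ∎
  where
  open ≡-Reasoning
  x/2<2ⁿ : x / 2 < 2 ^ n
  x/2<2ⁿ = m<n*o⇒m/o<n (subst (x <_) (ℕ.*-comm 2 (2 ^ n)) x<2ⁿ)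
  parity : ∀ {r} → r < 2 → digit (does (r ℕ.≟ 1)) ≡ r
  parity {0} _ = refl
  parity {1} _ = refl
  parity {suc (suc r)} (s≤s (s≤s ()))

zero⇔Empty : ∀ {n x} (S : Subset n) → x ≡ encode S → x ≡ 0 ⇔ Subset.Empty S
zero⇔Empty {n} S x≡S = mk⇔
  (λ x≡0 (w , w∈S) → Subset.∉⊥ (subst (w Subset.∈_)
    (encode-injective (trans (sym x≡S) (trans x≡0 (sym (encode-⊥ n))))) w∈S))
  (λ empty → trans x≡S (trans (cong encode (Subset.Empty-unique empty)) (encode-⊥ n)))

module _ {b n : ℕ} (n≤b : n ≤ b) where
  open Word b

  private
    bits-‼ : ∀ x {i} → i < b → bits x ‼ i ≡ bit x i
    bits-‼ x {i} i<b = begin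
      bits x ‼ i                       ≡⟨ cong (bits x ‼_) (Fin.toℕ-fromℕ< i<b) ⟨
      bits x ‼ toℕ (Fin.fromℕ< i<b)    ≡⟨ ‼-lookup (bits x) _ ⟩
      lookup (bits x) (Fin.fromℕ< i<b) ≡⟨ Vec.lookup∘tabulate _ (Fin.fromℕ< i<b) ⟩
      bit x (toℕ (Fin.fromℕ< i<b))     ≡⟨ cong (bit x) (Fin.toℕ-fromℕ< i<b) ⟩
      bit x i                          ∎
      where open ≡-Reasoning

    bits-encode-‼ : ∀ {m} → m ≤ b → (S : Subset m) → ∀ i → bits (encode S) ‼ i ≡ S ‼ i
    bits-encode-‼ m≤b S i with i ℕ.<? b
    ... | yes i<b = trans (bits-‼ (encode S) i<b) (bit-encode S i)
    ... | no  i≮b = trans (‼-≥ (bits (encode S)) b≤i) (sym (‼-≥ S (ℕ.≤-trans m≤b b≤i)))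
      where b≤i = ℕ.≮⇒≥ i≮b

  &-encode : (S T : Subset n) → encode S & encode T ≡ encode (S ∩ T)
  &-encode S T = encode-cong (bits (encode S) ∩ bits (encode T)) (S ∩ T) λ i → begin
    (bits (encode S) ∩ bits (encode T)) ‼ i
      ≡⟨ ‼-∩ (bits (encode S)) (bits (encode T)) i ⟩
    bits (encode S) ‼ i Bool.∧ bits (encode T) ‼ i
      ≡⟨ cong₂ Bool._∧_ (bits-encode-‼ n≤b S i) (bits-encode-‼ n≤b T i) ⟩
    S ‼ i Bool.∧ T ‼ i
      ≡⟨ ‼-∩ S T i ⟨
    (S ∩ T) ‼ i  ∎
    where open ≡-Reasoning

  ∣-encode : (S T : Subset n) → encode S ∣ encode T ≡ encode (S ∪ T)
  ∣-encode S T = encode-cong (bits (encode S) ∪ bits (encode T)) (S ∪ T) λ i → begin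
    (bits (encode S) ∪ bits (encode T)) ‼ i
      ≡⟨ ‼-∪ (bits (encode S)) (bits (encode T)) i ⟩
    bits (encode S) ‼ i Bool.∨ bits (encode T) ‼ i
      ≡⟨ cong₂ Bool._∨_ (bits-encode-‼ n≤b S i) (bits-encode-‼ n≤b T i) ⟩
    S ‼ i Bool.∨ T ‼ i
      ≡⟨ ‼-∪ S T i ⟨
    (S ∪ T) ‼ i  ∎
    where open ≡-Reasoning

  -- `~` also switches on the bits from `n` to `b - 1`; the conjunction with the full mask clears
  -- them.
  complement-encode : (S : Subset n) → fullMask n & ~ encode S ≡ encode (∁ S)
  complement-encode S = trans (cong (_& ~ encode S) (fullMask-⊤ n))
    (encode-cong (bits (encode ⊤ₙ) ∩ bits (encode S′)) (∁ S) λ i →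
      trans (‼-∩ (bits (encode ⊤ₙ)) (bits (encode S′)) i)
      (trans (cong₂ Bool._∧_ (bits-encode-‼ n≤b ⊤ₙ i) (bits-encode-‼ ℕ.≤-refl S′ i)) (inside i)))
    where
    ⊤ₙ = Subset.⊤ {n}
    S′ = ∁ (bits (encode S))
    inside : ∀ i → ⊤ₙ ‼ i Bool.∧ S′ ‼ i ≡ ∁ S ‼ i
    inside i with i ℕ.<? n
    ... | no  i≮n = trans (cong (Bool._∧ S′ ‼ i) (‼-≥ ⊤ₙ (ℕ.≮⇒≥ i≮n))) (sym (‼-≥ (∁ S) (ℕ.≮⇒≥ i≮n)))
    ... | yes i<n = begin
      ⊤ₙ ‼ i Bool.∧ S′ ‼ i       ≡⟨ cong (Bool._∧ S′ ‼ i) (‼-⊤ i<n) ⟩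
      S′ ‼ i                     ≡⟨ ‼-∁ (bits (encode S)) (ℕ.<-≤-trans i<n n≤b) ⟩
      Bool.not (bits (encode S) ‼ i)  ≡⟨ cong Bool.not (bits-encode-‼ n≤b S i) ⟩
      Bool.not (S ‼ i)                ≡⟨ ‼-∁ S i<n ⟨
      ∁ S ‼ i                    ∎
      where open ≡-Reasoning

  shift-encode : (w : Fin n) → 1<< toℕ w ≡ encode ⁅ w ⁆
  shift-encode w = trans
    (m<n⇒m%n≡m {{ℕ.m^n≢0 2 b}} (ℕ.^-monoʳ-< 2 (s≤s (s≤s z≤n)) (ℕ.<-≤-trans (Fin.toℕ<n w) n≤b)))
    (sym (encode-⁅⁆ w))

-- Decidability of truth and correctness of the recurrence

holds? : ∀ {n} (F : Frame n) V φ w → Dec (F , V , w ⊩ φ)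
holds? F V ⊤       w = yes _
holds? F V ⊥       w = no id
holds? F V (var i) w = w Subset.∈? V i
holds? F V (¬ φ)   w = ¬? (holds? F V φ w)
holds? F V (φ ∧ ψ) w = holds? F V φ w ×-dec holds? F V ψ w
holds? F V (φ ∨ ψ) w = holds? F V φ w ⊎-dec holds? F V ψ w
holds? F V (φ ⇒ ψ) w = holds? F V φ w →-dec holds? F V ψ w
holds? F V (□ φ)   w = Fin.all? λ v → v Subset.∈? lookup F w →-dec holds? F V φ v
holds? F V (◇ φ)   w = Fin.any? λ v → v Subset.∈? lookup F w ×-dec holds? F V φ v

truthSet : ∀ {n} → Frame n → Valuation n → Formula → Subset n
truthSet F V φ = tabulate λ w → does (holds? F V φ w)

∈-tabulate-does : ∀ {n} {P : Fin n → Set} (P? : ∀ w → Dec (P w)) {w} →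
  w Subset.∈ tabulate (does ∘ P?) ⇔ P w
∈-tabulate-does P? {w} = mk⇔
  (λ w∈ → witness (P? w) (trans (sym (Vec.lookup∘tabulate (does ∘ P?) w)) (Vec.[]=⇒lookup w∈)))
  (λ p → Vec.lookup⇒[]= w _ (trans (Vec.lookup∘tabulate (does ∘ P?) w) (Dec.dec-true (P? w) p)))
  where
  witness : ∀ {A : Set} (A? : Dec A) → does A? ≡ true → A
  witness (yes a) _ = a

zipWith-tabulate : ∀ {n} (_∙_ : Bool → Bool → Bool) (f g : Fin n → Bool) →
  Vec.zipWith _∙_ (tabulate f) (tabulate g) ≡ tabulate λ w → f w ∙ g w
zipWith-tabulate {zero}  _∙_ f g = refl
zipWith-tabulate {suc n} _∙_ f g = cong (f zero ∙ g zero ∷_) (zipWith-tabulate _∙_ (f ∘ suc) (g ∘ suc))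

tabulate-const : ∀ {n} (p : Bool) → tabulate (const p) ≡ Vec.replicate n p
tabulate-const {n} p = trans (Vec.tabulate-cong λ w → sym (Vec.lookup-replicate w p))
  (Vec.tabulate∘lookup (Vec.replicate n p))

tabulate-∈? : ∀ {n} (S : Subset n) → tabulate (λ w → does (w Subset.∈? S)) ≡ S
tabulate-∈? S = trans (Vec.tabulate-cong same) (Vec.tabulate∘lookup S)
  where
  same : ∀ w → does (w Subset.∈? S) ≡ lookup S w
  same w with w Subset.∈? S
  ... | yes w∈S = sym (Vec.[]=⇒lookup w∈S)
  ... | no  w∉S = sym (Bool.¬-not (w∉S ∘ Vec.lookup⇒[]= w S))

module _ {b n : ℕ} (n≤b : n ≤ b) (F : Frame n) (V : Valuation n) where
  open Word b
  open Recurrence b F V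

  private
    ⟦_⟧ : Formula → Subset n
    ⟦_⟧ = truthSet F V

    ∈-truth : ∀ φ {w} → w Subset.∈ ⟦ φ ⟧ ⇔ (F , V , w ⊩ φ)
    ∈-truth φ = ∈-tabulate-does (holds? F V φ)

    ᶜ-encode : ∀ φ → m φ ≡ encode ⟦ φ ⟧ → m φ ᶜ ≡ encode (∁ ⟦ φ ⟧)
    ᶜ-encode φ eq = trans (cong _ᶜ eq) (complement-encode n≤b ⟦ φ ⟧)

    ∁-truth : ∀ φ → ∁ ⟦ φ ⟧ ≡ ⟦ ¬ φ ⟧
    ∁-truth φ = sym (Vec.tabulate-∘ Bool.not _)

    □-truth : ∀ φ S → Subset.Empty (S ∩ ∁ ⟦ φ ⟧) ⇔ (∀ v → v Subset.∈ S → F , V , v ⊩ φ)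
    □-truth φ S = mk⇔
      -- Emptiness only refutes the failure of `φ` at `v`; decidability over finitely many worlds
      -- removes the double negation.
      (λ empty v v∈S → Dec.decidable-stable (holds? F V φ v) λ ⊮φ →
        empty (v , Subset.x∈p∩q⁺ (v∈S , Subset.x∉p⇒x∈∁p (⊮φ ∘ to (∈-truth φ)))))
      (λ all (v , v∈) → let v∈S , v∈∁φ = Subset.x∈p∩q⁻ S _ v∈ in
        Subset.x∈∁p⇒x∉p v∈∁φ (from (∈-truth φ) (all v v∈S)))
      where open Equivalence

    ◇-truth : ∀ φ S → (Nullary.¬ Subset.Empty (S ∩ ⟦ φ ⟧)) ⇔ (∃[ v ] v Subset.∈ S × (F , V , v ⊩ φ))
    ◇-truth φ S = mk⇔
      (λ nonempty → Dec.decidable-stable (Fin.any? λ v → v Subset.∈? S ×-dec holds? F V φ v) λ none →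
        nonempty λ (v , v∈) → let v∈S , v∈φ = Subset.x∈p∩q⁻ S _ v∈ in
          none (v , v∈S , to (∈-truth φ) v∈φ))
      (λ (v , v∈S , ⊩φ) empty → empty (v , Subset.x∈p∩q⁺ (v∈S , from (∈-truth φ) ⊩φ)))
      where open Equivalence

  -- A truth set is a table of decisions. Boolean connectives act on it entrywise, since `does` of a
  -- compound decision reduces to the Boolean operation; at modal nodes, decisions of equivalent
  -- propositions have the same `does`.
  m-truthSet : ∀ φ → m φ ≡ encode ⟦ φ ⟧
  m-truthSet ⊤ = trans (fullMask-⊤ n) (cong (encode {n}) (sym (tabulate-const true)))
  m-truthSet ⊥ = trans (sym (encode-⊥ n)) (cong (encode {n}) (sym (tabulate-const {n} false)))
  m-truthSet (var i) = cong (encode {n}) (sym (tabulate-∈? (V i)))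
  m-truthSet (¬ φ) = trans (ᶜ-encode φ (m-truthSet φ)) (cong (encode {n}) (∁-truth φ))
  m-truthSet (φ ∧ ψ) = trans (cong₂ _&_ (m-truthSet φ) (m-truthSet ψ))
    (trans (&-encode n≤b ⟦ φ ⟧ ⟦ ψ ⟧) (cong (encode {n}) (zipWith-tabulate Bool._∧_ _ _)))
  m-truthSet (φ ∨ ψ) = trans (cong₂ _∣_ (m-truthSet φ) (m-truthSet ψ))
    (trans (∣-encode n≤b ⟦ φ ⟧ ⟦ ψ ⟧) (cong (encode {n}) (zipWith-tabulate Bool._∨_ _ _)))
  m-truthSet (φ ⇒ ψ) = trans (cong₂ _∣_ (ᶜ-encode φ (m-truthSet φ)) (m-truthSet ψ))
    (trans (∣-encode n≤b (∁ ⟦ φ ⟧) ⟦ ψ ⟧) (cong (encode {n})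
      (trans (cong (_∪ ⟦ ψ ⟧) (∁-truth φ)) (zipWith-tabulate Bool._∨_ _ _))))
  m-truthSet (□ φ) = cong (encode {n}) (Vec.tabulate-cong λ w → does-⇔
    (□-truth φ (lookup F w) ⇔-∘ zero⇔Empty _
      (trans (cong (succMask w &_) (ᶜ-encode φ (m-truthSet φ))) (&-encode n≤b (lookup F w) (∁ ⟦ φ ⟧))))
    (_ ℕ.≟ 0) (holds? F V (□ φ) w))
  m-truthSet (◇ φ) = cong (encode {n}) (Vec.tabulate-cong λ w → does-⇔
    (◇-truth φ (lookup F w) ⇔-∘ ¬-cong-⇔ (zero⇔Empty _
      (trans (cong (succMask w &_) (m-truthSet φ)) (&-encode n≤b (lookup F w) ⟦ φ ⟧))))
    (¬? (_ ℕ.≟ 0)) (holds? F V (◇ φ) w))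

  m-full : ∀ φ → m φ ≡ fullMask n ⇔ (∀ w → F , V , w ⊩ φ)
  m-full φ = mk⇔
    (λ eq w → to (∈-truth φ) (subst (w Subset.∈_)
      (encode-injective (trans (sym (fullMask-⊤ n)) (trans (sym eq) (m-truthSet φ)))) Subset.∈⊤))
    (λ all → trans (m-truthSet φ) (trans (cong (encode {n}) (Subset.⊆-antisym Subset.⊆⊤
      (λ _ → from (∈-truth φ) (all _)))) (sym (fullMask-⊤ n))))
    where open Equivalence

-- Triples

update-≡ : ∀ (σ : Memory) c x → (σ [ c ≔ x ]) c ≡ x
update-≡ σ c x = cong (λ p → if p then x else σ c) (Dec.dec-true (c ≟ c) refl)

update-≢ : ∀ (σ : Memory) c x {c′} → c′ ≢ c → (σ [ c ≔ x ]) c′ ≡ σ c′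
update-≢ σ c x {c′} c′≢c = cong (λ p → if p then x else σ c′) (Dec.dec-false (c′ ≟ c) c′≢c)

Kept : (Cell → Set) → Memory → Memory → Set
Kept W σ τ = ∀ {c} → Nullary.¬ W c → τ c ≡ σ c

update-kept : ∀ {W} σ c x → W c → Kept W σ (σ [ c ≔ x ])
update-kept σ c x Wc ¬W = update-≢ σ c x λ where refl → ¬W Wc

-- `time` is an upper bound, so that branches of different cost share one triple. `kept` refers to
-- the predicate `W` and thus chains by transitivity along a sequence.
record Effect (R W : Cell → Set) (t : ℕ) (Q : Memory → Set) (σ : Memory) (o : Outcome) : Set where
  field
    post     : Q (memory o)
    kept     : Kept W σ (memory o)
    time     : ops o ≤ t
    readsIn  : All R (reads o)
    writesIn : All W (writes o)
open Effect

idle : ∀ {R W t} {Q : Memory → Set} {σ} → Q σ → Effect R W t Q σ (outcome σ 0 [] [])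
idle q = record { post = q ; kept = λ _ → refl ; time = z≤n ; readsIn = [] ; writesIn = [] }

bind : ∀ {R W t t′ Q Q′ σ o} k → Effect R W t Q σ o →
  (∀ {τ} → Kept W σ τ → Q τ → Effect R W t′ Q′ τ (k τ)) → Effect R W (t + t′) Q′ σ (o >>= k)
bind k e next = record
  { post     = post e′
  ; kept     = λ ¬W → trans (kept e′ ¬W) (kept e ¬W)
  ; time     = ℕ.+-mono-≤ (time e) (time e′)
  ; readsIn  = All.++⁺ (readsIn e) (readsIn e′)
  ; writesIn = All.++⁺ (writesIn e) (writesIn e′)
  }
  where e′ = next (kept e) (post e)

-- `iterate` raises `i` while lowering `k`, so the induction keeps `i + k` fixed. The invariant is
-- stated before the counter is set, and `step` also learns that everything outside `W` is as it was
-- in `σ` on entry to the loop.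
iterate-effect : ∀ {R W t n σ} body c (I : ℕ → Memory → Set) → R c → W c →
  (∀ (x : Fin n) {τ} → let τ′ = τ [ c ≔ toℕ x ] in
    Kept W σ τ′ → I (toℕ x) τ → Effect R W t (I (suc (toℕ x))) τ′ (body τ′)) →
  ∀ k i {τ} → i + k ≡ n → Kept W σ τ → I i τ → Effect R W (k * suc t) (I n) τ (iterate body c i k τ)
iterate-effect body c I Rc Wc step zero i i+0≡n keeps Iᵢ =
  idle (subst (λ i → I i _) (trans (sym (ℕ.+-identityʳ i)) i+0≡n) Iᵢ)
iterate-effect {R} {W} {t} {n} {σ} body c I Rc Wc step (suc k) i {τ} i+1+k≡n keeps Iᵢ =
  bind (iterate body c (suc i) k) (bind body start λ where _ refl → first) λ keeps″ I₁₊ᵢ →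
    iterate-effect body c I Rc Wc step k (suc i) 1+i+k≡n (λ ¬W → trans (keeps″ ¬W) (keeps ¬W)) I₁₊ᵢ
  where
  1+i+k≡n = trans (sym (ℕ.+-suc i k)) i+1+k≡n
  i<n : i < n
  i<n = subst (i <_) 1+i+k≡n (s≤s (ℕ.m≤m+n i k))
  keeps′ : Kept W σ (τ [ c ≔ i ])
  keeps′ ¬W = trans (update-kept τ c i Wc ¬W) (keeps ¬W)
  first : Effect R W t (I (suc i)) (τ [ c ≔ i ]) (body (τ [ c ≔ i ]))
  first = subst
    (λ i → Kept W σ (τ [ c ≔ i ]) → I i τ → Effect R W t (I (suc i)) (τ [ c ≔ i ]) (body (τ [ c ≔ i ])))
    (Fin.toℕ-fromℕ< i<n) (step (Fin.fromℕ< i<n)) keeps′ Iᵢ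
  start : Effect R W 1 (_≡ τ [ c ≔ i ]) τ (outcome (τ [ c ≔ i ]) 1 (c ∷ []) (c ∷ []))
  start = record
    { post = refl ; kept = update-kept τ c i Wc ; time = ℕ.≤-refl ; readsIn = Rc ∷ [] ; writesIn = Wc ∷ [] }

-- The accumulator of a modal loop after `i` worlds: the bits of the remaining worlds are still 0.
selectBelow : ∀ {n} → (Fin n → Bool) → ℕ → Subset n
selectBelow         g zero    = Subset.⊥
selectBelow {zero}  g (suc i) = []
selectBelow {suc n} g (suc i) = g zero ∷ selectBelow (g ∘ suc) i

selectBelow-insert : ∀ {n} (g : Fin n → Bool) v → g v ≡ true →
  selectBelow g (suc (toℕ v)) ≡ selectBelow g (toℕ v) ∪ ⁅ v ⁆
selectBelow-insert g zero    gv = cong₂ _∷_ gv (sym (Subset.∪-identityˡ Subset.⊥))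
selectBelow-insert g (suc v) gv =
  cong₂ _∷_ (sym (Bool.∨-identityʳ (g zero))) (selectBelow-insert (g ∘ suc) v gv)

selectBelow-skip : ∀ {n} (g : Fin n → Bool) v → g v ≡ false →
  selectBelow g (suc (toℕ v)) ≡ selectBelow g (toℕ v)
selectBelow-skip g zero    gv = cong (_∷ Subset.⊥) gv
selectBelow-skip g (suc v) gv = cong (g zero ∷_) (selectBelow-skip (g ∘ suc) v gv)

selectBelow-all : ∀ {n} (g : Fin n → Bool) → selectBelow g n ≡ tabulate g
selectBelow-all {zero}  g = refl
selectBelow-all {suc n} g = cong (g zero ∷_) (selectBelow-all (g ∘ suc))

-- Permitted reads and writes, and invariants

data Used (n f s : ℕ) (is : List ℕ) : Cell → Set where
  numWorlds : Used n f s is numWorlds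
  full      : Used n f s is full
  frame     : Used n f s is frame
  world     : Used n f s is world
  succ      : (w : Fin n) → Used n f s is (succ f (toℕ w))
  val       : ∀ {i} → i ∈ is → Used n f s is (val i)
  tmp       : ∀ {i} → i ≤ s → Used n f s is (tmp i)

-- The scratch cells form a stack: evaluation at depth `j` leaves the entries below `j` alone, and
-- `s` is its largest index.
data Assigned (j s : ℕ) : Cell → Set where
  world : Assigned j s world
  tmp   : ∀ {i} → j ≤ i → i ≤ s → Assigned j s (tmp i)

deeper : ∀ {j s c} → Assigned (suc j) s c → Assigned j s c
deeper world           = world
deeper (tmp j<i i≤s) = tmp (ℕ.<⇒≤ j<i) i≤s

-- Inside the loop nest only the variables in D have been set; the other counters hold stale values.
record Holds {n} (F : Frame n) (f : ℕ) (D : ℕ → Set) (V : Valuation n) (σ : Memory) : Set where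
  field
    current : σ frame ≡ f
    worlds  : σ numWorlds ≡ n
    ones    : σ full ≡ fullMask n
    masks   : ∀ w → σ (succ f (toℕ w)) ≡ encode (lookup F w)
    values  : ∀ {i} → D i → σ (val i) ≡ encode (V i)

holds-kept : ∀ {n} {F : Frame n} {f D V j s σ τ} → Kept (Assigned j s) σ τ → Holds F f D V σ → Holds F f D V τ
holds-kept keeps h = record
  { current = trans (keeps λ ()) current
  ; worlds  = trans (keeps λ ()) worlds
  ; ones    = trans (keeps λ ()) ones
  ; masks   = λ w → trans (keeps λ ()) (masks w)
  ; values  = λ Di → trans (keeps λ ()) (values Di)
  }
  where open Holds h

-- A verdict on an arbitrary proposition; inside the loop nest the proposition judged is weaker than
-- validity. For `F ⊨ φ` this unfolds to the same type as `Verdict`.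
Marks : Set → ℕ → Set
Marks P x = Σ[ d ∈ Dec P ] x ≡ (if does d then 1 else 0)

-- Both directions matter: a verdict of 0 asserts the negation and has to be transported too.
marks-⇔ : ∀ {P Q x} → P ⇔ Q → Marks P x → Marks Q x
marks-⇔ P⇔Q (d , eq) = Dec.map P⇔Q d , eq

_[_↦_] : ∀ {n} → Valuation n → ℕ → Subset n → Valuation n
(V [ i ↦ S ]) i′ = if does (i′ ℕ.≟ i) then S else V i′

↦-≡ : ∀ {n} (V : Valuation n) i S → (V [ i ↦ S ]) i ≡ S
↦-≡ V i S = cong (λ p → if p then S else V i) (Dec.dec-true (i ℕ.≟ i) refl)

↦-≢ : ∀ {n} (V : Valuation n) {i i′} S → i′ ≢ i → (V [ i ↦ S ]) i′ ≡ V i′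
↦-≢ V {i} {i′} S i′≢i = cong (λ p → if p then S else V i′) (Dec.dec-false (i′ ℕ.≟ i) i′≢i)

-- Here `is` lists only the variables of the loops still inside, so the counters of the outer loops
-- are provably preserved.
data EnumerationWrites (f s : ℕ) (is : List ℕ) : Cell → Set where
  evaluation : ∀ {c} → Assigned 0 s c → EnumerationWrites f s is c
  val        : ∀ {i} → i ∈ is → EnumerationWrites f s is (val i)
  ans        : EnumerationWrites f s is (ans f)

written-ans : ∀ {f g s is} → EnumerationWrites f s is (ans g) → g ≡ f
written-ans (evaluation ())
written-ans ans = refl

data DecisionReads (N n s : ℕ) (is : List ℕ) : Cell → Set where
  numFrames    : DecisionReads N n s is numFrames
  currentFrame : DecisionReads N n s is frame
  forFrame     : (f : Fin N) → ∀ {c} → Used n (toℕ f) s is c → DecisionReads N n s is c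

data DecisionWrites (N s : ℕ) (is : List ℕ) : Cell → Set where
  frame    : DecisionWrites N s is frame
  forFrame : (f : Fin N) → ∀ {c} → EnumerationWrites (toℕ f) s is c → DecisionWrites N s is c

-- Since `M ^ k ≥ 1`, the operation spent on each loop step is paid for by adding one to the cost of
-- every innermost run.
enumerationCost : ∀ M .{{_ : NonZero M}} e k → M * suc (M ^ k * (e + k)) ≤ M ^ suc k * (e + suc k)
enumerationCost M e k = begin
  M * suc (M ^ k * (e + k))      ≤⟨ ℕ.*-monoʳ-≤ M (ℕ.+-monoˡ-≤ (M ^ k * (e + k)) (ℕ.m^n>0 M k)) ⟩
  M * (M ^ k + M ^ k * (e + k))  ≡⟨ identity M (M ^ k) e k ⟩
  M ^ suc k * (e + suc k)        ∎
  where
  open ℕ.≤-Reasoning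
  identity : ∀ M A e k → M * (A + A * (e + k)) ≡ M * A * (e + suc k)
  identity = solve-∀

size-positive : ∀ φ → 1 ≤ size φ
size-positive ⊤       = s≤s z≤n
size-positive ⊥       = s≤s z≤n
size-positive (var i) = s≤s z≤n
size-positive (¬ φ)   = s≤s z≤n
size-positive (□ φ)   = s≤s z≤n
size-positive (◇ φ)   = s≤s z≤n
size-positive (φ ∧ ψ) = s≤s z≤n
size-positive (φ ∨ ψ) = s≤s z≤n
size-positive (φ ⇒ ψ) = s≤s z≤n

binary-cost : ∀ a c d e n → 5 * (a + d * n) + (5 * (c + e * n) + 1) ≤ 5 * suc (a + c + (d + e) * n)
binary-cost a c d e n = ℕ.m+n≤o⇒m≤o _ {4} (ℕ.≤-reflexive (identity a c d e n))
  where
  identity : ∀ a c d e n → 5 * (a + d * n) + (5 * (c + e * n) + 1) + 4 ≡ 5 * suc (a + c + (d + e) * n)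
  identity = solve-∀

-- Rules for the program constructs

module _ (b : ℕ) where
  open Word b
  open Machine b

  -- Indexed by the program instead of its outcome, so that unification finds `p` rather than an
  -- unfolded `run p σ`.
  record Runs (R W : Cell → Set) (t : ℕ) (Q : Memory → Set) (σ : Memory) (p : Program) : Set where
    constructor runs
    field effect : Effect R W t Q σ (run p σ)
  open Runs public

  weaken : ∀ {R R′ W W′ t t′ Q Q′ σ p} → (∀ {c} → R c → R′ c) → (∀ {c} → W c → W′ c) → t ≤ t′ →
    (∀ {τ} → Kept W σ τ → Q τ → Q′ τ) → Runs R W t Q σ p → Runs R′ W′ t′ Q′ σ p
  weaken R⊆ W⊆ t≤ Q⇒ (runs e) = runs record
    { post     = Q⇒ (kept e) (post e)
    ; kept     = λ ¬W′ → kept e (¬W′ ∘ W⊆)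
    ; time     = ℕ.≤-trans (time e) t≤
    ; readsIn  = All.map R⊆ (readsIn e)
    ; writesIn = All.map W⊆ (writesIn e)
    }

  skip-runs : ∀ {R W t Q σ} → Q σ → Runs R W t Q σ skip
  skip-runs q = runs (idle q)

  infixr 1 _⨾-runs_

  _⨾-runs_ : ∀ {R W t t′ Q Q′ σ p q} → Runs R W t Q σ p →
    (∀ {τ} → Kept W σ τ → Q τ → Runs R W t′ Q′ τ q) → Runs R W (t + t′) Q′ σ (p ⨾ q)
  _⨾-runs_ {q = q} (runs e) next = runs (bind (run q) e λ keeps post → effect (next keeps post))

  assign-runs : ∀ {R W Q σ r e} → W (address σ r) → All R (addressing r ++ exprReads σ e) →
    Q (σ [ address σ r ≔ eval σ e ]) → Runs R W 1 Q σ (r := e)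
  assign-runs {σ = σ} {r} Wr Re q = runs record
    { post     = q
    ; kept     = update-kept σ (address σ r) _ Wr
    ; time     = ℕ.≤-refl
    ; readsIn  = Re
    ; writesIn = Wr ∷ []
    }

  test-runs : ∀ {R W t Q σ o o′ p q} → All R (operandReads σ o ++ operandReads σ o′) →
    (value σ o ≡ value σ o′ → Runs R W t Q σ p) →
    (value σ o ≢ value σ o′ → Runs R W t Q σ q) →
    Runs R W (suc t) Q σ (test o == o′ then p else q)
  test-runs {R} {W} {t} {Q} {σ} {o} {o′} {p} {q} Ro onEq onNe =
    runs (bind (if does (value σ o ℕ.≟ value σ o′) then run p else run q) compare
      λ where _ refl → branch (value σ o ℕ.≟ value σ o′))
    where
    compare : Effect R W 1 (_≡ σ) σ (outcome σ 1 (operandReads σ o ++ operandReads σ o′) [])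
    compare = record { post = refl ; kept = λ _ → refl ; time = ℕ.≤-refl ; readsIn = Ro ; writesIn = [] }
    branch : (eq? : Dec (value σ o ≡ value σ o′)) →
      Effect R W t Q σ ((if does eq? then run p else run q) σ)
    branch (yes eq) = effect (onEq eq)
    branch (no  ne) = effect (onNe ne)

  private
    readBound : ∀ {R W} {Q : Memory → Set} {σ d} → R d → Q σ → Effect R W 0 Q σ (outcome σ 0 (d ∷ []) [])
    readBound Rd q = record { post = q ; kept = λ _ → refl ; time = z≤n ; readsIn = Rd ∷ [] ; writesIn = [] }

  for-below-runs : ∀ {R W t n σ c d p} (I : ℕ → Memory → Set) → σ d ≡ n → R d → R c → W c → I 0 σ →
    (∀ (x : Fin n) {τ} → let τ′ = τ [ c ≔ toℕ x ] in
      Kept W σ τ′ → I (toℕ x) τ → Runs R W t (I (suc (toℕ x))) τ′ p) →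
    Runs R W (n * suc t) (I n) σ (for c below d repeat p)
  for-below-runs {σ = σ} {c} {d} {p} I refl Rd Rc Wc I₀ step =
    runs (bind (iterate (run p) c 0 (σ d)) (readBound {Q = _≡ σ} Rd refl) λ where
      _ refl → iterate-effect (run p) c I Rc Wc (λ x keeps Iₓ → effect (step x keeps Iₓ))
        (σ d) 0 refl (λ _ → refl) I₀)

  -- The inclusive bound makes `2 ^ n` iterations possible with the bound `full`; for `n = b` the
  -- number `2 ^ n` itself is not a word.
  for-upto-runs : ∀ {R W t n σ c d p} (I : ℕ → Memory → Set) → suc (σ d) ≡ n → R d → R c → W c → I 0 σ →
    (∀ (x : Fin n) {τ} → let τ′ = τ [ c ≔ toℕ x ] in
      Kept W σ τ′ → I (toℕ x) τ → Runs R W t (I (suc (toℕ x))) τ′ p) →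
    Runs R W (n * suc t) (I n) σ (for c upto d repeat p)
  for-upto-runs {σ = σ} {c} {d} {p} I refl Rd Rc Wc I₀ step =
    runs (bind (iterate (run p) c 0 (suc (σ d))) (readBound {Q = _≡ σ} Rd refl) λ where
      _ refl → iterate-effect (run p) c I Rc Wc (λ x keeps Iₓ → effect (step x keeps Iₓ))
        (suc (σ d)) 0 refl (λ _ → refl) I₀)

  -- Evaluation of a formula in one model

  module _ {n} (n≤b : n ≤ b) (F : Frame n) (f s : ℕ) (is : List ℕ) where

    private
      U = Used n f s is
      A = λ j → Assigned j s

    module _ (V : Valuation n) where
      open Recurrence b F V

      private
        H = Holds F f (_∈ is) V

      complement-runs : ∀ {j i σ} → j ≤ s → i ≤ s → σ full ≡ fullMask n →
        Runs U (A j) 2 (λ τ → τ (tmp j) ≡ σ (tmp i) ᶜ) σ (complement j i)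
      complement-runs {j} {i} {σ} j≤s i≤s ones =
        assign-runs (tmp ℕ.≤-refl j≤s) (tmp i≤s ∷ [])
          (update-≡ σ (tmp j) _) ⨾-runs λ {τ} keeps tmp≡ →
        assign-runs (tmp ℕ.≤-refl j≤s) (full ∷ tmp j≤s ∷ [])
          (trans (update-≡ τ (tmp j) _) (cong₂ _&_ (trans (keeps λ ()) ones) tmp≡))

      -- The mask in `tmp (suc j)` lies in the range that `A j` allows to be overwritten, so its
      -- survival has to be part of the postcondition.
      setCurrentBit-runs : ∀ {j σ} (w : Fin n) S → 2 + j ≤ s → σ world ≡ toℕ w → σ (tmp j) ≡ encode S →
        Runs U (A j) 2 (λ τ → τ (tmp j) ≡ encode (S ∪ ⁅ w ⁆) × τ (tmp (suc j)) ≡ σ (tmp (suc j)))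
          σ (setCurrentBit j)
      setCurrentBit-runs {j} {σ} w S 2+j≤s world≡w tmp≡S =
        assign-runs {Q = λ τ → τ (tmp (2 + j)) ≡ encode ⁅ w ⁆ × τ (tmp j) ≡ encode S
                             × τ (tmp (suc j)) ≡ σ (tmp (suc j))}
          (tmp (ℕ.m≤n+m j 2) 2+j≤s) (world ∷ [])
          ( trans (update-≡ σ (tmp (2 + j)) _) (trans (cong 1<<_ world≡w) (shift-encode n≤b w))
          , trans (update-≢ σ (tmp (2 + j)) _ λ ()) tmp≡S
          , update-≢ σ (tmp (2 + j)) _ λ ()) ⨾-runs λ {τ} _ (bit≡ , tmp≡S′ , same) →
        assign-runs (tmp ℕ.≤-refl j≤s) (tmp j≤s ∷ tmp 2+j≤s ∷ [])
          ( trans (update-≡ τ (tmp j) _) (trans (cong₂ _∣_ tmp≡S′ bit≡) (∣-encode n≤b S ⁅ w ⁆))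
          , trans (update-≢ τ (tmp j) _ λ ()) same)
        where j≤s = ℕ.≤-trans (ℕ.m≤n+m j 2) 2+j≤s

      -- The loops of □ and ◇ in one: p = true sets the bits of the worlds whose masked
      -- successors are empty, p = false those of the others.
      setCurrentBitIf : ℕ → Bool → Program
      setCurrentBitIf j true  = setCurrentBit j
      setCurrentBitIf j false = skip

      setCurrentBitIf-runs : ∀ {j σ} g p (w : Fin n) → 2 + j ≤ s → σ world ≡ toℕ w →
        σ (tmp j) ≡ encode (selectBelow g (toℕ w)) → g w ≡ p →
        Runs U (A j) 2
          (λ τ → τ (tmp j) ≡ encode (selectBelow g (suc (toℕ w))) × τ (tmp (suc j)) ≡ σ (tmp (suc j)))
          σ (setCurrentBitIf j p)
      setCurrentBitIf-runs g true w 2+j≤s world≡w tmp≡ gw =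
        weaken id id ℕ.≤-refl
          (λ _ (eq , same) → trans eq (cong (encode {n}) (sym (selectBelow-insert g w gw))) , same)
          (setCurrentBit-runs w (selectBelow g (toℕ w)) 2+j≤s world≡w tmp≡)
      setCurrentBitIf-runs g false w 2+j≤s world≡w tmp≡ gw =
        skip-runs (trans tmp≡ (cong (encode {n}) (sym (selectBelow-skip g w gw))) , refl)

      scan : ℕ → Bool → Program
      scan j p =
        at (tmp j) := get (lit 0) ⨾
        for world below numWorlds repeat (
          at (tmp (2 + j)) := ref succ[·] and ↑ (tmp (suc j)) ⨾
          test ↑ (tmp (2 + j)) == lit 0 then setCurrentBitIf j p else setCurrentBitIf j (Bool.not p))

      -- Arranged so that `selected true` and `selected false` reduce to the bits in the clauses of
      -- `m` for `□` and `◇`.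
      selected : Bool → ℕ → Fin n → Bool
      selected p x w = if p then does (succMask w & x ℕ.≟ 0) else Bool.not (does (succMask w & x ℕ.≟ 0))

      selected-zero : ∀ p {x} w → succMask w & x ≡ 0 → selected p x w ≡ p
      selected-zero true  w eq = Dec.dec-true (_ ℕ.≟ 0) eq
      selected-zero false w eq = cong Bool.not (Dec.dec-true (_ ℕ.≟ 0) eq)

      selected-nonzero : ∀ p {x} w → succMask w & x ≢ 0 → selected p x w ≡ Bool.not p
      selected-nonzero true  w ne = Dec.dec-false (_ ℕ.≟ 0) ne
      selected-nonzero false w ne = cong Bool.not (Dec.dec-false (_ ℕ.≟ 0) ne)

      scan-runs : ∀ {j σ} p x → 2 + j ≤ s → H σ → σ (tmp (suc j)) ≡ x →
        Runs U (A j) (1 + n * 5) (λ τ → τ (tmp j) ≡ encode (tabulate (selected p x))) σ (scan j p)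
      scan-runs {j} {σ} p x 2+j≤s h tmp≡x =
        assign-runs {Q = λ τ → τ (tmp j) ≡ 0 × τ (tmp (suc j)) ≡ x} (tmp ℕ.≤-refl j≤s) []
          (update-≡ σ (tmp j) 0 , trans (update-≢ σ (tmp j) 0 λ ()) tmp≡x) ⨾-runs λ keeps (tmp≡0 , tmp≡x′) →
        weaken id id ℕ.≤-refl (λ _ (eq , _) → trans eq (cong (encode {n}) (selectBelow-all g)))
          (for-below-runs (λ i τ → τ (tmp j) ≡ encode (selectBelow g i) × τ (tmp (suc j)) ≡ x)
            (Holds.worlds (holds-kept keeps h)) numWorlds world world
            (trans tmp≡0 (sym (encode-⊥ n)) , tmp≡x′)
            (λ w keeps′ (tmp≡ , tmp≡x″) → body w (holds-kept keeps′ (holds-kept keeps h)) refl tmp≡ tmp≡x″))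
        where
        j≤s = ℕ.≤-trans (ℕ.m≤n+m j 2) 2+j≤s
        g = selected p x
        body : ∀ w {τ} → H τ → τ world ≡ toℕ w →
          τ (tmp j) ≡ encode (selectBelow g (toℕ w)) → τ (tmp (suc j)) ≡ x →
          Runs U (A j) 4 (λ υ → υ (tmp j) ≡ encode (selectBelow g (suc (toℕ w))) × υ (tmp (suc j)) ≡ x) τ
            (at (tmp (2 + j)) := ref succ[·] and ↑ (tmp (suc j)) ⨾
             test ↑ (tmp (2 + j)) == lit 0 then setCurrentBitIf j p else setCurrentBitIf j (Bool.not p))
        body w {τ} hτ world≡w tmp≡ tmp≡x″ =
          assign-runs {Q = λ υ → υ (tmp (2 + j)) ≡ succMask w & x × υ (tmp j) ≡ encode (selectBelow g (toℕ w))
                          × υ (tmp (suc j)) ≡ x × υ world ≡ toℕ w}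
            (tmp (ℕ.m≤n+m j 2) 2+j≤s)
            (subst U (sym address≡) (succ w) ∷ frame ∷ world ∷ tmp (ℕ.≤-trans (ℕ.n≤1+n (suc j)) 2+j≤s) ∷ [])
            ( trans (update-≡ τ (tmp (2 + j)) _) (cong₂ _&_ (trans (cong τ address≡) (masks w)) tmp≡x″)
            , trans (update-≢ τ (tmp (2 + j)) _ λ ()) tmp≡
            , trans (update-≢ τ (tmp (2 + j)) _ λ ()) tmp≡x″
            , world≡w) ⨾-runs λ _ (masked≡ , tmp≡′ , tmp≡x‴ , world≡w′) →
          test-runs (tmp 2+j≤s ∷ [])
            (λ eq → weaken id id ℕ.≤-refl (λ _ (eq′ , same) → eq′ , trans same tmp≡x‴)
              (setCurrentBitIf-runs g p w 2+j≤s world≡w′ tmp≡′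
                (selected-zero p w (trans (sym masked≡) eq))))
            (λ ne → weaken id id ℕ.≤-refl (λ _ (eq′ , same) → eq′ , trans same tmp≡x‴)
              (setCurrentBitIf-runs g (Bool.not p) w 2+j≤s world≡w′ tmp≡′
                (selected-nonzero p w (ne ∘ trans masked≡))))
          where
          open Holds hτ
          address≡ : address τ succ[·] ≡ succ f (toℕ w)
          address≡ = cong₂ succ current world≡w

      -- The stack depth rises by one on entering a right argument, and a modal node reaches two
      -- cells above `j`. Counting nodes bounds both, so `s = size φ` suffices from depth 0.
      evaluate-runs : ∀ φ {j σ} → j + size φ ≤ s → (∀ {i} → i ∈ occurrences φ → i ∈ is) → H σ →
        Runs U (A j) (5 * (size φ + modalNodes φ * n)) (λ τ → τ (tmp j) ≡ m φ) σ (evaluateAt j φ)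

      private
        module Room (φ : Formula) {j : ℕ} (room : j + suc (size φ) ≤ s) where
          left : j + size φ ≤ s
          left = ℕ.≤-trans (ℕ.+-monoʳ-≤ j (ℕ.n≤1+n (size φ))) room
          right : suc j + size φ ≤ s
          right = subst (_≤ s) (ℕ.+-suc j (size φ)) room
          j<s : suc j ≤ s
          j<s = ℕ.m+n≤o⇒m≤o (suc j) right
          j≤s : j ≤ s
          j≤s = ℕ.<⇒≤ j<s
          -- The argument of a modal node has at least one node, which pays for the second extra
          -- cell.
          j+2≤s : 2 + j ≤ s
          j+2≤s = ℕ.≤-trans
            (ℕ.≤-trans (ℕ.≤-reflexive (ℕ.+-comm 1 (suc j))) (ℕ.+-monoʳ-≤ (suc j) (size-positive φ)))
            right

        firstRoom : ∀ φ ψ {j} → j + suc (size φ + size ψ) ≤ s → j + size φ ≤ s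
        firstRoom φ ψ {j} = ℕ.≤-trans (ℕ.+-monoʳ-≤ j (ℕ.m≤n⇒m≤1+n (ℕ.m≤m+n (size φ) (size ψ))))

        secondRoom : ∀ φ ψ {j} → j + suc (size φ + size ψ) ≤ s → suc j + size ψ ≤ s
        secondRoom φ ψ {j} room = ℕ.≤-trans (ℕ.+-monoʳ-≤ (suc j) (ℕ.m≤n+m (size ψ) (size φ)))
          (subst (_≤ s) (ℕ.+-suc j _) room)

        -- The value of the left argument in `tmp j` survives because the right one is evaluated a
        -- level deeper, where only cells from `suc j` on are written.
        combine-runs : ∀ ψ {j σ x y e} → suc j + size ψ ≤ s → (∀ {i} → i ∈ occurrences ψ → i ∈ is) →
          H σ → σ (tmp j) ≡ x →
          (∀ {τ} → τ (tmp j) ≡ x → τ (tmp (suc j)) ≡ m ψ → All U (exprReads τ e) × eval τ e ≡ y) →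
          Runs U (A j) (5 * (size ψ + modalNodes ψ * n) + 1) (λ τ → τ (tmp j) ≡ y)
            σ (evaluateAt (suc j) ψ ⨾ at (tmp j) := e)
        combine-runs ψ {j} room ⊆is h tmp≡x combine =
          weaken id deeper ℕ.≤-refl
            (λ keeps eq → trans (keeps λ where (tmp j<j _) → ℕ.1+n≰n j<j) tmp≡x , eq)
            (evaluate-runs ψ room ⊆is h) ⨾-runs λ {τ} _ (eq , eq′) →
          let reads , eval≡ = combine eq eq′ in
          assign-runs (tmp ℕ.≤-refl (ℕ.<⇒≤ (ℕ.m+n≤o⇒m≤o (suc j) room))) reads
            (trans (update-≡ τ (tmp j) _) eval≡)

      evaluate-runs ⊤ {j} {σ} room ⊆is h = weaken id id (ℕ.m≤m+n 1 4) (λ _ eq → trans eq (Holds.ones h))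
        (assign-runs {Q = λ τ → τ (tmp j) ≡ σ full} (tmp ℕ.≤-refl j≤s) (full ∷ []) (update-≡ σ (tmp j) _))
        where j≤s = ℕ.m+n≤o⇒m≤o j room
      evaluate-runs ⊥ {j} {σ} room ⊆is h = weaken id id (ℕ.m≤m+n 1 4) (λ _ eq → eq)
        (assign-runs {Q = λ τ → τ (tmp j) ≡ 0} (tmp ℕ.≤-refl j≤s) [] (update-≡ σ (tmp j) _))
        where j≤s = ℕ.m+n≤o⇒m≤o j room
      evaluate-runs (var i) {j} {σ} room ⊆is h =
        weaken id id (ℕ.m≤m+n 1 4) (λ _ eq → trans eq (Holds.values h i∈is))
        (assign-runs {Q = λ τ → τ (tmp j) ≡ σ (val i)} (tmp ℕ.≤-refl j≤s) (val i∈is ∷ [])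
          (update-≡ σ (tmp j) _))
        where
        j≤s = ℕ.m+n≤o⇒m≤o j room
        i∈is = ⊆is (here refl)
      evaluate-runs (¬ φ) {j} room ⊆is h =
        weaken id id (cost (size φ + modalNodes φ * n)) (λ _ eq → eq)
          (evaluate-runs φ left ⊆is h ⨾-runs λ keeps eq →
           weaken id id ℕ.≤-refl (λ _ eq′ → trans eq′ (cong _ᶜ eq))
             (complement-runs j≤s j≤s (Holds.ones (holds-kept keeps h))))
        where
        open Room φ room
        cost : ∀ a → 5 * a + 2 ≤ 5 * suc a
        cost a = ℕ.m+n≤o⇒m≤o _ {3} (ℕ.≤-reflexive (identity a))
          where
          identity : ∀ a → 5 * a + 2 + 3 ≡ 5 * suc a
          identity = solve-∀
      evaluate-runs (φ ∧ ψ) {j} room ⊆is h =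
        weaken id id (binary-cost (size φ) (size ψ) (modalNodes φ) (modalNodes ψ) n) (λ _ eq → eq)
          (evaluate-runs φ (firstRoom φ ψ room) (⊆is ∘ ∈-++⁺ˡ) h ⨾-runs λ keeps eq →
           combine-runs ψ room′ (⊆is ∘ ∈-++⁺ʳ (occurrences φ)) (holds-kept keeps h) eq
             λ eq₁ eq₂ → tmp (ℕ.<⇒≤ j<s) ∷ tmp j<s ∷ [] , cong₂ _&_ eq₁ eq₂)
        where
        room′ = secondRoom φ ψ room
        j<s = ℕ.m+n≤o⇒m≤o (suc j) room′
      evaluate-runs (φ ∨ ψ) {j} room ⊆is h =
        weaken id id (binary-cost (size φ) (size ψ) (modalNodes φ) (modalNodes ψ) n) (λ _ eq → eq)
          (evaluate-runs φ (firstRoom φ ψ room) (⊆is ∘ ∈-++⁺ˡ) h ⨾-runs λ keeps eq →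
           combine-runs ψ room′ (⊆is ∘ ∈-++⁺ʳ (occurrences φ)) (holds-kept keeps h) eq
             λ eq₁ eq₂ → tmp (ℕ.<⇒≤ j<s) ∷ tmp j<s ∷ [] , cong₂ _∣_ eq₁ eq₂)
        where
        room′ = secondRoom φ ψ room
        j<s = ℕ.m+n≤o⇒m≤o (suc j) room′
      evaluate-runs (φ ⇒ ψ) {j} room ⊆is h =
        weaken id id (cost (size φ) (size ψ) (modalNodes φ) (modalNodes ψ) n) (λ _ eq → eq)
          (evaluate-runs φ (firstRoom φ ψ room) (⊆is ∘ ∈-++⁺ˡ) h ⨾-runs λ keeps eq →
           complement-runs (ℕ.<⇒≤ j<s) (ℕ.<⇒≤ j<s) (Holds.ones (holds-kept keeps h)) ⨾-runs λ keeps′ eq′ →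
           combine-runs ψ room′ (⊆is ∘ ∈-++⁺ʳ (occurrences φ)) (holds-kept keeps′ (holds-kept keeps h))
             (trans eq′ (cong _ᶜ eq))
             λ eq₁ eq₂ → tmp (ℕ.<⇒≤ j<s) ∷ tmp j<s ∷ [] , cong₂ _∣_ eq₁ eq₂)
        where
        room′ = secondRoom φ ψ room
        j<s = ℕ.m+n≤o⇒m≤o (suc j) room′
        cost : ∀ a c d e n → 5 * (a + d * n) + (2 + (5 * (c + e * n) + 1)) ≤ 5 * suc (a + c + (d + e) * n)
        cost a c d e n = ℕ.m+n≤o⇒m≤o _ {2} (ℕ.≤-reflexive (identity a c d e n))
          where
          identity : ∀ a c d e n →
            5 * (a + d * n) + (2 + (5 * (c + e * n) + 1)) + 2 ≡ 5 * suc (a + c + (d + e) * n)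
          identity = solve-∀
      evaluate-runs (□ φ) {j} room ⊆is h =
        weaken id id (cost (size φ) (modalNodes φ) n) (λ _ eq → eq)
          (evaluate-runs φ left ⊆is h ⨾-runs λ keeps eq →
           weaken id deeper ℕ.≤-refl (λ _ eq′ → trans eq′ (cong _ᶜ eq))
             (complement-runs j<s j≤s (Holds.ones (holds-kept keeps h))) ⨾-runs λ keeps′ eq′ →
           scan-runs true (m φ ᶜ) j+2≤s (holds-kept keeps′ (holds-kept keeps h)) eq′)
        where
        open Room φ room
        cost : ∀ a d n → 5 * (a + d * n) + (2 + (1 + n * 5)) ≤ 5 * suc (a + suc d * n)
        cost a d n = ℕ.m+n≤o⇒m≤o _ {2} (ℕ.≤-reflexive (identity a d n))
          where
          identity : ∀ a d n → 5 * (a + d * n) + (2 + (1 + n * 5)) + 2 ≡ 5 * suc (a + suc d * n)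
          identity = solve-∀
      evaluate-runs (◇ φ) {j} room ⊆is h =
        weaken id id (cost (size φ) (modalNodes φ) n) (λ _ eq → eq)
          (evaluate-runs φ left ⊆is h ⨾-runs λ {τ} keeps eq →
           assign-runs {Q = λ υ → υ (tmp (suc j)) ≡ m φ} (tmp (ℕ.n≤1+n j) j<s) (tmp j≤s ∷ [])
             (trans (update-≡ τ (tmp (suc j)) _) eq) ⨾-runs λ keeps′ eq′ →
           scan-runs false (m φ) j+2≤s (holds-kept keeps′ (holds-kept keeps h)) eq′)
        where
        open Room φ room
        cost : ∀ a d n → 5 * (a + d * n) + (1 + (1 + n * 5)) ≤ 5 * suc (a + suc d * n)
        cost a d n = ℕ.m+n≤o⇒m≤o _ {3} (ℕ.≤-reflexive (identity a d n))
          where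
          identity : ∀ a d n → 5 * (a + d * n) + (1 + (1 + n * 5)) + 3 ≡ 5 * suc (a + suc d * n)
          identity = solve-∀

  -- Enumeration of valuations and frames

  module _ {n} (n≤b : n ≤ b) (φ : Formula) where

    private
      js = vars φ
      s  = size φ

    -- The extra 2 pays for the comparison with `full` and a possible write of the verdict 0.
    checkCost : ℕ
    checkCost = 5 * (size φ + modalNodes φ * n) + 2

    module _ (F : Frame n) (f : ℕ) where

      private
        U = Used n f s js
        H = λ is → Holds F f (λ i → i ∈ js × i ∉ is)

      -- Restricted to the variables of `φ`: for `is = js` the condition is vacuous, and `Covers`
      -- turns into validity on the frame.
      AgreeOff : List ℕ → Valuation n → Valuation n → Set
      AgreeOff is V V′ = ∀ i → i ∈ js → i ∉ is → V′ i ≡ V i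

      Covers : List ℕ → Valuation n → Set
      Covers is V = ∀ V′ → AgreeOff is V V′ → ∀ w → F , V′ , w ⊩ φ

      check : Program
      check = evaluate φ ⨾ test ↑ (tmp 0) == ↑ full then skip else (ans[·] := get (lit 0))

      check-runs : ∀ {P V σ} → H [] V σ → Marks P (σ (ans f)) →
        Runs U (EnumerationWrites f s []) checkCost (λ τ → Marks (P × Covers [] V) (τ (ans f))) σ check
      check-runs {P} {V} {σ} h marked =
        evaluated ⨾-runs λ {τ} _ (eq , marked′ , h′) → let open Holds h′ in
        test-runs (tmp z≤n ∷ full ∷ [])
          (λ tmp≡full → skip-runs (marks-⇔
            (mk⇔ (λ p → p , λ V′ agree →
                    to (m-full n≤b F V′ φ) (trans (sym (eq V′ agree)) (trans tmp≡full ones)))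
                 proj₁)
            marked′))
          (λ tmp≢full → assign-runs (subst (EnumerationWrites f s [] ∘ ans) (sym current) ans) (frame ∷ [])
            -- `V` itself is the countermodel, as it agrees with itself.
            ( no (λ (_ , covers) → tmp≢full (trans (eq V λ _ _ _ → refl)
                (trans (from (m-full n≤b F V φ) (covers V λ _ _ _ → refl)) (sym ones))))
            , trans (cong (λ g → (τ [ ans g ≔ 0 ]) (ans f)) current) (update-≡ τ (ans f) 0)))
        where
        open Equivalence
        evaluateWith : ∀ V′ → AgreeOff [] V V′ →
          Runs U (Assigned 0 s) (5 * (size φ + modalNodes φ * n))
            (λ τ → τ (tmp 0) ≡ Recurrence.m b F V′ φ) σ (evaluate φ)
        evaluateWith V′ agree = evaluate-runs n≤b F f s js V′ φ ℕ.≤-refl (∈-deduplicate⁺ ℕ._≟_) record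
          { current = current
          ; worlds  = worlds
          ; ones    = ones
          ; masks   = masks
          ; values  = λ i∈js → trans (values (i∈js , λ ())) (cong encode (sym (agree _ i∈js λ ())))
          }
          where open Holds h
        evaluated : Runs U (EnumerationWrites f s []) (5 * (size φ + modalNodes φ * n))
          (λ τ → (∀ V′ → AgreeOff [] V V′ → τ (tmp 0) ≡ Recurrence.m b F V′ φ)
               × Marks P (τ (ans f)) × H [] V τ)
          σ (evaluate φ)
        evaluated = weaken id evaluation ℕ.≤-refl
          (λ keeps eq → eq , subst (Marks P) (sym (keeps λ ())) marked , holds-kept keeps h) (runs record
          -- The memory represents every `V′` that agrees with `V` on the variables of `φ`, so one
          -- and the same run computes `m` for all of them. This takes the place of a lemma that
          -- truth depends only on those variables.
          { post     = λ V′ agree → post (effect (evaluateWith V′ agree))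
          ; kept     = kept e
          ; time     = time e
          ; readsIn  = readsIn e
          ; writesIn = writesIn e
          })
          where e = effect (evaluateWith V λ _ _ _ → refl)

      -- `P` stands for whatever the verdict recorded before this part of the nest. Generalising
      -- over it lets successive iterations accumulate conjuncts, since a check can only lower the
      -- verdict to 0.
      forValuations-runs : ∀ is {P V σ} → (∀ {i} → i ∈ is → i ∈ js) → H is V σ → Marks P (σ (ans f)) →
        Runs U (EnumerationWrites f s is) ((2 ^ n) ^ length is * (checkCost + length is))
          (λ τ → Marks (P × Covers is V) (τ (ans f))) σ (forValuations is check)
      forValuations-runs [] ⊆js h marked =
        weaken id id (ℕ.≤-reflexive (sym (trans (ℕ.*-identityˡ _) (ℕ.+-identityʳ _)))) (λ _ q → q)
          (check-runs h marked)
      forValuations-runs (i ∷ is) {P} {V} {σ} ⊆js h marked =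
        weaken id id (enumerationCost (2 ^ n) {{ℕ.m^n≢0 2 n}} checkCost (length is)) (λ _ → marks-⇔ finish)
          (for-upto-runs (λ x τ → Marks (P × Covered x) (τ (ans f)))
            (trans (cong suc (Holds.ones h)) (suc-fullMask n)) full (val (⊆js (here refl))) (val (here refl))
            (marks-⇔ (mk⇔ (λ p → p , λ _ ()) proj₁) marked)
            λ x keeps marked′ → weaken id inner ℕ.≤-refl (λ _ → marks-⇔ (extend x))
              (forValuations-runs is (⊆js ∘ there) (holds x keeps) marked′))
        where
        -- The counter is itself the mask of the value of `i`, so the subsets tried after `x`
        -- iterations are those with mask below `x`.
        Covered : ℕ → Set
        Covered x = ∀ S → encode S < x → Covers is (V [ i ↦ S ])

        i′∉∷ : ∀ {i′} → i′ ≢ i → i′ ∉ is → i′ ∉ i ∷ is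
        i′∉∷ i′≢i i′∉is (here eq)     = i′≢i eq
        i′∉∷ i′≢i i′∉is (there i′∈is) = i′∉is i′∈is

        inner : ∀ {c} → EnumerationWrites f s is c → EnumerationWrites f s (i ∷ is) c
        inner (evaluation w) = evaluation w
        inner (val i∈is)     = val (there i∈is)
        inner ans            = ans

        digits : Fin (2 ^ n) → Subset n
        digits x = Word.bits n (toℕ x)

        encode-digits : ∀ x → encode (digits x) ≡ toℕ x
        encode-digits x = encode-bits n (Fin.toℕ<n x)

        holds : ∀ x {τ} → Kept (EnumerationWrites f s (i ∷ is)) σ (τ [ val i ≔ toℕ x ]) →
          H is (V [ i ↦ digits x ]) (τ [ val i ≔ toℕ x ])
        holds x {τ} keeps = record
          { current = trans (keeps λ where (evaluation ())) current
          ; worlds  = trans (keeps λ where (evaluation ())) worlds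
          ; ones    = trans (keeps λ where (evaluation ())) ones
          ; masks   = λ w → trans (keeps λ where (evaluation ())) (masks w)
          ; values  = λ {i′} (i′∈js , i′∉is) → value≡ i′ (i′ ℕ.≟ i) i′∈js i′∉is
          }
          where
          open Holds h
          value≡ : ∀ i′ → Dec (i′ ≡ i) → i′ ∈ js → i′ ∉ is →
            (τ [ val i ≔ toℕ x ]) (val i′) ≡ encode ((V [ i ↦ digits x ]) i′)
          value≡ i′ (yes refl) _ _ = trans (update-≡ τ (val i) _)
            (trans (sym (encode-digits x)) (cong encode (sym (↦-≡ V i (digits x)))))
          value≡ i′ (no i′≢i) i′∈js i′∉is = trans (keeps ¬written)
            (trans (values (i′∈js , i′∉i∷is)) (cong encode (sym (↦-≢ V (digits x) i′≢i))))
            where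
            i′∉i∷is = i′∉∷ i′≢i i′∉is
            ¬written : Nullary.¬ EnumerationWrites f s (i ∷ is) (val i′)
            ¬written (evaluation ())
            ¬written (val i′∈i∷is) = i′∉i∷is i′∈i∷is

        extend : ∀ x → ((P × Covered (toℕ x)) × Covers is (V [ i ↦ digits x ])) ⇔ (P × Covered (suc (toℕ x)))
        extend x = mk⇔
          (λ ((p , covered) , covers) → p , λ S S<1+x → new covered covers S (ℕ.m≤n⇒m<n∨m≡n (s≤s⁻¹ S<1+x)))
          (λ (p , covered) → (p , λ S S<x → covered S (ℕ.m<n⇒m<1+n S<x)) ,
                             covered (digits x) (s≤s (ℕ.≤-reflexive (encode-digits x))))
          where
          new : Covered (toℕ x) → Covers is (V [ i ↦ digits x ]) →
            ∀ S → encode S < toℕ x ⊎ encode S ≡ toℕ x → Covers is (V [ i ↦ S ])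
          new covered covers S (inj₁ S<x) = covered S S<x
          new covered covers S (inj₂ S≡x) =
            subst (λ S → Covers is (V [ i ↦ S ])) (encode-injective (trans (encode-digits x) (sym S≡x))) covers

        finish : (P × Covered (2 ^ n)) ⇔ (P × Covers (i ∷ is) V)
        finish = mk⇔
          -- `V′` is met when the counter equals the mask of `V′ i`, which is below `2 ^ n`.
          (λ (p , covered) → p , λ V′ agree → covered (V′ i) (encode-< (V′ i)) V′ (restrict V′ agree))
          (λ (p , covers) → p , λ S _ V′ agree → covers V′ λ i′ i′∈js i′∉i∷is →
            trans (agree i′ i′∈js (i′∉i∷is ∘ there)) (↦-≢ V S (i′∉i∷is ∘ here)))
          where
          restrict : ∀ V′ → AgreeOff (i ∷ is) V V′ → AgreeOff is (V [ i ↦ V′ i ]) V′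
          restrict V′ agree i′ i′∈js i′∉is = cases (i′ ℕ.≟ i)
            where
            cases : Dec (i′ ≡ i) → V′ i′ ≡ (V [ i ↦ V′ i ]) i′
            cases (yes refl) = sym (↦-≡ V i (V′ i))
            cases (no i′≢i)  = trans (agree i′ i′∈js (i′∉∷ i′≢i i′∉is)) (sym (↦-≢ V (V′ i) i′≢i))

    decideCost : ℕ → ℕ
    decideCost N = N * suc (1 + (2 ^ n) ^ length js * (checkCost + length js))

    decide-runs : ∀ {N σ} (𝔉 : Vec (Frame n) N) → HoldsFrames σ 𝔉 →
      Runs (DecisionReads N n s js) (DecisionWrites N s js) (decideCost N)
        (λ τ → ∀ f → Verdict (lookup 𝔉 f) φ (τ (ans (toℕ f)))) σ (decide φ)
    decide-runs {N} {σ} 𝔉 h =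
      weaken id id ℕ.≤-refl (λ _ verdicts f → verdicts f (Fin.toℕ<n f))
        (for-below-runs (λ x τ → ∀ f → toℕ f < x → Verdict (lookup 𝔉 f) φ (τ (ans (toℕ f))))
          frames numFrames currentFrame frame (λ _ ())
          λ f keeps verdicts → weaken (forFrame f) (forFrame f) ℕ.≤-refl (collect f verdicts) (one f keeps))
      where
      open HoldsFrames h

      one : ∀ f {τ} → let τ′ = τ [ frame ≔ toℕ f ] in Kept (DecisionWrites N s js) σ τ′ →
        Runs (Used n (toℕ f) s js) (EnumerationWrites (toℕ f) s js)
          (1 + (2 ^ n) ^ length js * (checkCost + length js))
          (λ υ → Verdict (lookup 𝔉 f) φ (υ (ans (toℕ f)))) τ′
          (ans[·] := get (lit 1) ⨾ forValuations js (check (lookup 𝔉 f) (toℕ f)))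
      one f {τ} keeps =
        assign-runs {Q = λ υ → υ (ans (toℕ f)) ≡ 1} ans (frame ∷ [])
          (update-≡ (τ [ frame ≔ toℕ f ]) (ans (toℕ f)) 1)
        ⨾-runs λ keeps′ marked →
        weaken id id ℕ.≤-refl (λ _ → marks-⇔ (mk⇔
            (λ (_ , covers) V → covers V λ i i∈js i∉js → contradiction i∈js i∉js)
            (λ valid → Unit.tt , λ V _ → valid V)))
          -- No variable has been set yet, so the valuation is a placeholder. The true proposition
          -- matches the initial verdict 1.
          (forValuations-runs (lookup 𝔉 f) (toℕ f) js {P = Unit.⊤} {V = const Subset.⊥} id
            record
              { current = keeps′ λ where (evaluation ())
              ; worlds  = trans (keeps′ λ where (evaluation ()))
                                  (trans (keeps λ where (forFrame _ (evaluation ()))) worlds)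
              ; ones    = trans (keeps′ λ where (evaluation ()))
                                  (trans (keeps λ where (forFrame _ (evaluation ()))) ones)
              ; masks   = λ w → trans (keeps′ λ where (evaluation ()))
                                  (trans (keeps λ where (forFrame _ (evaluation ()))) (masks f w))
              ; values  = λ (i∈js , i∉js) → contradiction i∈js i∉js
              }
            (yes Unit.tt , marked))

      -- Verdicts on earlier frames persist, since the only answer cell written while processing
      -- frame `f` is its own.
      collect : ∀ f {τ υ} → (∀ g → toℕ g < toℕ f → Verdict (lookup 𝔉 g) φ (τ (ans (toℕ g)))) →
        Kept (EnumerationWrites (toℕ f) s js) τ υ → Verdict (lookup 𝔉 f) φ (υ (ans (toℕ f))) →
        ∀ g → toℕ g < suc (toℕ f) → Verdict (lookup 𝔉 g) φ (υ (ans (toℕ g)))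
      collect f {υ = υ} verdicts keeps verdict g g<1+f with ℕ.m≤n⇒m<n∨m≡n (s≤s⁻¹ g<1+f)
      ... | inj₁ g<f = subst (Verdict (lookup 𝔉 g) φ)
        (sym (keeps (ℕ.<⇒≢ g<f ∘ written-ans))) (verdicts g g<f)
      ... | inj₂ g≡f = subst (λ g → Verdict (lookup 𝔉 g) φ (υ (ans (toℕ g))))
        (sym (Fin.toℕ-injective g≡f)) verdict

-- Space and time bounds

-- Pigeonhole: after deleting one occurrence of the head from `ys`, the tail is still contained in
-- the rest, as the head does not recur in it.
Unique-⊆⇒length≤ : ∀ {A : Set} {xs ys : List A} → List.Unique xs → xs ⊆ ys → length xs ≤ length ys
Unique-⊆⇒length≤ {xs = []} _ _ = z≤n
Unique-⊆⇒length≤ {xs = x ∷ xs} (x∉xs ∷ unique) xs⊆ys with ∈-∃++ (xs⊆ys (here refl))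
... | as , bs , refl = ℕ.≤-trans
  (s≤s (Unique-⊆⇒length≤ unique λ z∈xs → drop-x z∈xs (∈-++⁻ as (xs⊆ys (there z∈xs)))))
  (ℕ.≤-reflexive (sym (List.length-++-sucʳ as x bs)))
  where
  drop-x : ∀ {z} → z ∈ xs → z ∈ as ⊎ z ∈ x ∷ bs → z ∈ as ++ bs
  drop-x z∈xs (inj₁ z∈as)         = ∈-++⁺ˡ z∈as
  drop-x z∈xs (inj₂ (here refl))  = contradiction refl (All.lookup x∉xs z∈xs)
  drop-x z∈xs (inj₂ (there z∈bs)) = ∈-++⁺ʳ as z∈bs

length-cartesianProductWith : ∀ {A B C : Set} (f : A → B → C) xs ys →
  length (List.cartesianProductWith f xs ys) ≡ length xs * length ys
length-cartesianProductWith f []       ys = refl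
length-cartesianProductWith f (x ∷ xs) ys = trans (List.length-++ (List.map (f x) ys))
  (cong₂ _+_ (List.length-map (f x) ys) (length-cartesianProductWith f xs ys))

length-occurrences : ∀ φ → length (occurrences φ) ≤ size φ
length-occurrences ⊤       = z≤n
length-occurrences ⊥       = z≤n
length-occurrences (var i) = ℕ.≤-refl
length-occurrences (¬ φ)   = ℕ.m≤n⇒m≤1+n (length-occurrences φ)
length-occurrences (□ φ)   = ℕ.m≤n⇒m≤1+n (length-occurrences φ)
length-occurrences (◇ φ)   = ℕ.m≤n⇒m≤1+n (length-occurrences φ)
length-occurrences (φ ∧ ψ) = ℕ.m≤n⇒m≤1+n (ℕ.≤-trans (ℕ.≤-reflexive (List.length-++ (occurrences φ)))
  (ℕ.+-mono-≤ (length-occurrences φ) (length-occurrences ψ)))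
length-occurrences (φ ∨ ψ) = ℕ.m≤n⇒m≤1+n (ℕ.≤-trans (ℕ.≤-reflexive (List.length-++ (occurrences φ)))
  (ℕ.+-mono-≤ (length-occurrences φ) (length-occurrences ψ)))
length-occurrences (φ ⇒ ψ) = ℕ.m≤n⇒m≤1+n (ℕ.≤-trans (ℕ.≤-reflexive (List.length-++ (occurrences φ)))
  (ℕ.+-mono-≤ (length-occurrences φ) (length-occurrences ψ)))

numVars≤size : ∀ φ → numVars φ ≤ size φ
numVars≤size φ = ℕ.≤-trans (List.length-deduplicate ℕ._≟_ (occurrences φ)) (length-occurrences φ)

scratch : Formula → List Cell
scratch φ = frame ∷ world ∷ List.map tmp (List.upTo (suc (size φ))) ++ List.map val (vars φ)

-- Two counters, `size φ + 1` scratch cells and at most `size φ` variables; the constant 3 is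
-- charged to the size, which is positive.
length-scratch : ∀ φ → length (scratch φ) ≤ 5 * size φ
length-scratch φ = begin
  length (scratch φ)              ≡⟨ cong (2 +_) (trans (List.length-++ tmps) (cong₂ _+_ length-tmps length-vals)) ⟩
  3 + (size φ + numVars φ)        ≤⟨ ℕ.+-mono-≤ (ℕ.*-monoʳ-≤ 3 (size-positive φ))
                                       (ℕ.+-monoʳ-≤ (size φ) (numVars≤size φ)) ⟩
  3 * size φ + (size φ + size φ)  ≡⟨ identity (size φ) ⟩
  5 * size φ                      ∎
  where
  open ℕ.≤-Reasoning
  tmps = List.map tmp (List.upTo (suc (size φ)))
  length-tmps : length tmps ≡ suc (size φ)
  length-tmps = trans (List.length-map tmp (List.upTo (suc (size φ)))) (List.length-upTo (suc (size φ)))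
  length-vals : length (List.map val (vars φ)) ≡ numVars φ
  length-vals = List.length-map val (vars φ)
  identity : ∀ s → 3 * s + (s + s) ≡ 5 * s
  identity = solve-∀

module _ (φ : Formula) where

  tmp∈scratch : ∀ {i} → i ≤ size φ → tmp i ∈ scratch φ
  tmp∈scratch i≤s = there (there (∈-++⁺ˡ (∈-map⁺ tmp (∈-upTo⁺ (s≤s i≤s)))))

  val∈scratch : ∀ {i} → i ∈ vars φ → val i ∈ scratch φ
  val∈scratch i∈ = there (there (∈-++⁺ʳ (List.map tmp (List.upTo (suc (size φ)))) (∈-map⁺ val i∈)))

  writes-location : ∀ {N c} → DecisionWrites N (size φ) (vars φ) c → IsAnswerOf N c ⊎ c ∈ scratch φ
  writes-location frame                                = inj₂ (here refl)
  writes-location (forFrame f (evaluation world))       = inj₂ (there (here refl))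
  writes-location (forFrame f (evaluation (tmp _ i≤s))) = inj₂ (tmp∈scratch i≤s)
  writes-location (forFrame f (val i∈is))               = inj₂ (val∈scratch i∈is)
  writes-location (forFrame f ans)                      = inj₁ (toℕ f , Fin.toℕ<n f , refl)

  reads-location : ∀ {N n c} → DecisionReads N n (size φ) (vars φ) c → c ∈ inputCells N n ⊎ c ∈ scratch φ
  reads-location numFrames              = inj₁ (here refl)
  reads-location currentFrame           = inj₂ (here refl)
  reads-location (forFrame f numWorlds) = inj₁ (there (here refl))
  reads-location (forFrame f full)      = inj₁ (there (there (here refl)))
  reads-location (forFrame f frame)     = inj₂ (here refl)
  reads-location (forFrame f world)     = inj₂ (there (here refl))
  reads-location (forFrame f (succ w))  = inj₁ (there (there (there
    (∈-cartesianProductWith⁺ succ (∈-upTo⁺ (Fin.toℕ<n f)) (∈-upTo⁺ (Fin.toℕ<n w))))))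
  reads-location (forFrame f (val i∈))  = inj₂ (val∈scratch i∈)
  reads-location (forFrame f (tmp i≤s)) = inj₂ (tmp∈scratch i≤s)

  cellsUsed-bound : ∀ {N n o} .{{_ : NonZero n}} →
    All (DecisionReads N n (size φ) (vars φ)) (reads o) →
    All (DecisionWrites N (size φ) (vars φ)) (writes o) →
    cellsUsed N n o ≤ 8 * (N * n + size φ)
  cellsUsed-bound {N} {n} {o} readsIn writesIn = begin
    cellsUsed N n o
      ≤⟨ Unique-⊆⇒length≤ (List.deduplicate-! _≟_ all) (covered ∘ ∈-deduplicate⁻ _≟_ all) ⟩
    length (inputCells N n ++ answers ++ scratch φ)
      ≡⟨ trans (List.length-++ (inputCells N n)) (cong₂ _+_ length-input
           (trans (List.length-++ answers) (cong (_+ length (scratch φ)) length-answers))) ⟩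
    3 + N * n + (N + length (scratch φ))
      ≤⟨ ℕ.+-mono-≤ (ℕ.+-monoˡ-≤ (N * n) (ℕ.*-monoʳ-≤ 3 (size-positive φ)))
           (ℕ.+-mono-≤ (ℕ.m≤m*n N n) (length-scratch φ)) ⟩
    3 * size φ + N * n + (N * n + 5 * size φ)
      -- The size has coefficient 3 + 5 = 8, while `N * n` has only 2, one for the masks and one for
      -- the answers; it is raised to match.
      ≤⟨ ℕ.m≤m+n _ (6 * (N * n)) ⟩
    3 * size φ + N * n + (N * n + 5 * size φ) + 6 * (N * n)
      ≡⟨ identity (size φ) (N * n) ⟩
    8 * (N * n + size φ)  ∎
    where
    open ℕ.≤-Reasoning
    all = inputCells N n ++ reads o ++ writes o
    answers = List.map ans (List.upTo N)
    length-answers : length answers ≡ N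
    length-answers = trans (List.length-map ans (List.upTo N)) (List.length-upTo N)
    length-input : length (inputCells N n) ≡ 3 + N * n
    length-input = cong (3 +_) (trans (length-cartesianProductWith succ (List.upTo N) (List.upTo n))
      (cong₂ _*_ (List.length-upTo N) (List.length-upTo n)))
    identity : ∀ s x → 3 * s + x + (x + 5 * s) + 6 * x ≡ 8 * (x + s)
    identity = solve-∀
    fromScratch : ∀ {c} → c ∈ scratch φ → c ∈ inputCells N n ++ answers ++ scratch φ
    fromScratch = ∈-++⁺ʳ (inputCells N n) ∘ ∈-++⁺ʳ answers
    read : ∀ {c} → c ∈ inputCells N n ⊎ c ∈ scratch φ → c ∈ inputCells N n ++ answers ++ scratch φ
    read (inj₁ c∈) = ∈-++⁺ˡ c∈
    read (inj₂ c∈) = fromScratch c∈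
    written : ∀ {c} → IsAnswerOf N c ⊎ c ∈ scratch φ → c ∈ inputCells N n ++ answers ++ scratch φ
    written (inj₁ (f , f<N , refl)) = ∈-++⁺ʳ (inputCells N n) (∈-++⁺ˡ (∈-map⁺ ans (∈-upTo⁺ f<N)))
    written (inj₂ c∈)               = fromScratch c∈
    used : ∀ {c} → c ∈ reads o ⊎ c ∈ writes o → c ∈ inputCells N n ++ answers ++ scratch φ
    used (inj₁ c∈) = read (reads-location (All.lookup readsIn c∈))
    used (inj₂ c∈) = written (writes-location (All.lookup writesIn c∈))
    covered : all ⊆ inputCells N n ++ answers ++ scratch φ
    covered c∈ with ∈-++⁻ (inputCells N n) c∈
    ... | inj₁ c∈input = ∈-++⁺ˡ c∈input
    ... | inj₂ c∈run   = used (∈-++⁻ (reads o) c∈run)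

  decideCost-bound : ∀ {b n} (n≤b : n ≤ b) N →
    decideCost b n≤b φ N ≤ 10 * (N * 2 ^ (numVars φ * n) * (size φ + modalNodes φ * n))
  decideCost-bound {b} {n} n≤b N = begin
    N * suc (1 + (2 ^ n) ^ k * (5 * e + 2 + k))  ≡⟨ cong (λ A → N * suc (1 + A * (5 * e + 2 + k))) 2^n^k≡A ⟩
    -- Both the 2 outside and the 2 inside are at most `2 * e`, and `k ≤ e`: hence 2 for the frame
    -- and 5 + 2 + 1 for each valuation.
    N * (2 + A * (5 * e + 2 + k))                ≤⟨ ℕ.*-monoʳ-≤ N (ℕ.+-mono-≤ 2≤2Ae (ℕ.*-monoʳ-≤ A 5e+2+k≤8e)) ⟩
    N * (A * (2 * e) + A * (8 * e))              ≡⟨ identity N A e ⟩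
    10 * (N * A * e)                             ∎
    where
    open ℕ.≤-Reasoning
    k = numVars φ
    e = size φ + modalNodes φ * n
    A = 2 ^ (k * n)
    2^n^k≡A : (2 ^ n) ^ k ≡ A
    2^n^k≡A = trans (ℕ.^-*-assoc 2 n k) (cong (2 ^_) (ℕ.*-comm n k))
    1≤e : 1 ≤ e
    1≤e = ℕ.≤-trans (size-positive φ) (ℕ.m≤m+n (size φ) _)
    2≤2Ae : 2 ≤ A * (2 * e)
    2≤2Ae = ℕ.*-mono-≤ (ℕ.m^n>0 2 (k * n)) (ℕ.*-monoʳ-≤ 2 1≤e)
    5e+2+k≤8e : 5 * e + 2 + k ≤ 8 * e
    5e+2+k≤8e = begin
      5 * e + 2 + k      ≤⟨ ℕ.+-mono-≤ (ℕ.+-monoʳ-≤ (5 * e) (ℕ.*-monoʳ-≤ 2 1≤e))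
                              (ℕ.≤-trans (numVars≤size φ) (ℕ.m≤m+n (size φ) _)) ⟩
      5 * e + 2 * e + e  ≡⟨ sum≡ e ⟩
      8 * e              ∎
      where
      sum≡ : ∀ e → 5 * e + 2 * e + e ≡ 8 * e
      sum≡ = solve-∀
    identity : ∀ N A e → N * (A * (2 * e) + A * (8 * e)) ≡ 10 * (N * A * e)
    identity = solve-∀

-- The third component is the memory bound for a fixed formula; the fourth has a universal constant
-- and shows the contribution of `φ`. The fifth expresses that no truth tensor is stored: apart from
-- one answer per frame, all writes go to a list of cells chosen from `φ` alone, before the frames
-- and `n` are given.
proposition1 : (∃[ C ] ∀ (φ : Formula) (b n : ℕ) (F : Frame n) (V : Valuation n) (σ : Memory) →
    n ≤ b → HoldsModel σ F V →
    let o = Machine.run b (evaluate φ) σ in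
    memory o (tmp 0) ≡ Recurrence.m b F V φ
    × ops o ≤ C * (size φ + modalNodes φ * n))
    ×
    (∃[ C ] ∀ (φ : Formula) (b n N : ℕ) (𝔉 : Vec (Frame n) N) (σ : Memory) →
    n ≤ b → Unique 𝔉 → HoldsFrames σ 𝔉 →
    let o = Machine.run b (decide φ) σ in
    (∀ f → Verdict (lookup 𝔉 f) φ (memory o (ans (toℕ f))))
    × ops o ≤ C * (N * 2 ^ (numVars φ * n) * (size φ + modalNodes φ * n)))
    ×
    (∀ (φ : Formula) → ∃[ C ] ∀ (b n N : ℕ) (𝔉 : Vec (Frame n) N) (σ : Memory) →
    .{{NonZero n}} → .{{NonZero N}} →
    n ≤ b → Unique 𝔉 → HoldsFrames σ 𝔉 →
    cellsUsed N n (Machine.run b (decide φ) σ) ≤ C * (N * n))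
    ×
    (∃[ C ] ∀ (φ : Formula) (b n N : ℕ) (𝔉 : Vec (Frame n) N) (σ : Memory) →
    .{{NonZero n}} →
    n ≤ b → Unique 𝔉 → HoldsFrames σ 𝔉 →
    cellsUsed N n (Machine.run b (decide φ) σ) ≤ C * (N * n + size φ))
    ×
    (∃[ C ] ∀ (φ : Formula) → ∃[ scratch ] length scratch ≤ C * size φ ×
    (∀ (b n N : ℕ) (𝔉 : Vec (Frame n) N) (σ : Memory) →
    n ≤ b → Unique 𝔉 → HoldsFrames σ 𝔉 →
    All (λ c → IsAnswerOf N c ⊎ c ∈ scratch) (writes (Machine.run b (decide φ) σ))))
proposition1 =
  (5 , λ φ b n F V σ n≤b h →
    let open HoldsModel h
        e = effect (evaluate-runs b n≤b F (σ frame) (size φ) (vars φ) V φ ℕ.≤-refl (∈-deduplicate⁺ ℕ._≟_)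
              record
                { current = refl
                ; worlds  = worlds
                ; ones    = ones
                ; masks   = masks
                ; values  = λ _ → values _
                })
    in post e , time e) ,
  (10 , λ φ b n N 𝔉 σ n≤b _ h →
    let e = effect (decide-runs b n≤b φ 𝔉 h)
    in post e , ℕ.≤-trans (time e) (decideCost-bound φ n≤b N)) ,
  -- As `N * n` is positive, the additive `size φ` is at most `size φ * (N * n)`.
  (λ φ → 8 * suc (size φ) , λ b n N 𝔉 σ n≤b _ h →
    ℕ.≤-trans (space φ b n N 𝔉 σ n≤b h) (fixed-formula (size φ) (N * n) {{ℕ.m*n≢0 N n}})) ,
  (8 , λ φ b n N 𝔉 σ n≤b _ h → space φ b n N 𝔉 σ n≤b h) ,
  (5 , λ φ → scratch φ , length-scratch φ , λ b n N 𝔉 σ n≤b _ h →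
    All.map (writes-location φ) (writesIn (effect (decide-runs b n≤b φ 𝔉 h))))
  where
  space : ∀ φ b n N (𝔉 : Vec (Frame n) N) σ .{{_ : NonZero n}} → n ≤ b → HoldsFrames σ 𝔉 →
    cellsUsed N n (Machine.run b (decide φ) σ) ≤ 8 * (N * n + size φ)
  space φ b n N 𝔉 σ n≤b h = cellsUsed-bound φ {o = Machine.run b (decide φ) σ} (readsIn e) (writesIn e)
    where e = effect (decide-runs b n≤b φ 𝔉 h)
  fixed-formula : ∀ s x .{{_ : NonZero x}} → 8 * (x + s) ≤ 8 * suc s * x
  fixed-formula s x = begin
    8 * (x + s)      ≤⟨ ℕ.*-monoʳ-≤ 8 (ℕ.+-monoʳ-≤ x (ℕ.m≤m*n s x)) ⟩
    8 * (x + s * x)  ≡⟨ ℕ.*-assoc 8 (suc s) x ⟨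
    8 * suc s * x    ∎
    where open ℕ.≤-Reasoning
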